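{- Let $n$ and $\Delta$ be positive integers such that $\Delta\ge \frac{3(n-1)}{4}$. If $G$ is obtained from an $(n-1)$-vertex $\Delta$-regular Class 1 graph by a vertex-splitting, then $G$ is $\Delta$-critical.
   Context: All graphs are finite and simple. For a graph $G$ with maximum degree $\Delta(G)$, the chromatic index $\chi'(G)$ is the least $k$ such that $E(G)$ can be properly edge-colored with $k$ colors; $G$ is Class 1 if $\chi'(G)=\Delta(G)$ and Class 2 otherwise. A graph $G$ is $\Delta$-critical (with $\Delta=\Delta(G)$) if $\chi'(G)=\Delta+1$ and $\chi'(H)<\Delta+1$ for every proper subgraph $H$ of $G$. Vertex-splitting: let $v$ be a vertex of $G$ with $d_G(v)=t\ge 2$ and $N_G(v)=\{u_1,\dots,u_t\}$; splitting $v$ into two new vertices $v_1,v_2$ gives the graph $G'$ with $V(G')=(V(G)\setminus\{v\})\cup\{v_1,v_2\}$ and $E(G')=E(G-v)\cup\{v_1v_2\}\cup\{v_1u_i: i\in[1,s]\}\cup\{v_2u_i: i\in[s+1,t]\}$ for some integer $s\in[1,t-1]$. -}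

module Defs where

open import Data.Nat using (ℕ; zero; suc; _≤_; _<_; _⊔_; _+_)
open import Data.Bool using (Bool; true; false; not; _∧_; if_then_else_)
open import Data.Fin using (Fin; zero; suc; _≟_)
open import Data.Fin.Permutation using (Permutation′; _⟨$⟩ʳ_)
open import Data.List using (List; foldr; map; allFin)
open import Data.Nat.ListAction using (sum)
open import Data.Maybe using (Maybe; just; nothing)
import Data.Maybe as M
open import Data.Product using (Σ; ∃; _×_; _,_)
open import Data.Sum using (_⊎_)
open import Function.Definitions using (Injective)
open import Relation.Binary.PropositionalEquality using (_≡_; _≢_)
open import Relation.Nullary using (yes; no)

record Graph (n : ℕ) : Set where
  field
    adj    : Fin n → Fin n → Bool
    sym    : ∀ u v → adj u v ≡ adj v u
    irrefl : ∀ v → adj v v ≡ false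
open Graph public

deg : ∀ {n} → Graph n → Fin n → ℕ
deg {n} G v = sum (map (λ u → if adj G v u then 1 else 0) (allFin n))

maxDeg : ∀ {n} → Graph n → ℕ
maxDeg {n} G = foldr _⊔_ 0 (map (deg G) (allFin n))

Regular : ∀ {n} → Graph n → ℕ → Set
Regular G d = ∀ v → deg G v ≡ d

-- c is a proper edge coloring of G with k colours:
-- c u v is the colour of edge uv (only meaningful when uv ∈ E(G)).
ProperEdgeColoring : ∀ {n} → Graph n → (k : ℕ) → (Fin n → Fin n → Fin k) → Set
ProperEdgeColoring {n} G k c =
  (∀ u v → adj G u v ≡ true → c u v ≡ c v u) ×
  (∀ u v w → adj G u v ≡ true → adj G u w ≡ true → c u v ≡ c u w → v ≡ w)

EdgeColorable : ∀ {n} → Graph n → ℕ → Set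
EdgeColorable {n} G k = Σ (Fin n → Fin n → Fin k) (ProperEdgeColoring G k)

ChromaticIndex : ∀ {n} → Graph n → ℕ → Set
ChromaticIndex G k = EdgeColorable G k × (∀ j → EdgeColorable G j → k ≤ j)

Class1 : ∀ {n} → Graph n → Set
Class1 G = ChromaticIndex G (maxDeg G)

IsSubgraph : ∀ {m n} → Graph m → Graph n → (Fin m → Fin n) → Set
IsSubgraph H G f = Injective _≡_ _≡_ f ×
  (∀ a b → adj H a b ≡ true → adj G (f a) (f b) ≡ true)

ProperSub : ∀ {m n} → Graph m → Graph n → (Fin m → Fin n) → Set
ProperSub {m} H G f =
  (∃ λ v → ∀ a → f a ≢ v) ⊎
  (∃ λ u → ∃ λ v → adj G u v ≡ true ×
     (∀ a b → f a ≡ u → f b ≡ v → adj H a b ≡ false))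

Critical : ∀ {n} → Graph n → ℕ → Set
Critical {n} G Δ =
  maxDeg G ≡ Δ × ChromaticIndex G (suc Δ) ×
  (∀ m (H : Graph m) (f : Fin m → Fin n) → IsSubgraph H G f → ProperSub H G f →
     ∃ λ k → ChromaticIndex H k × k < suc Δ)

-- Vertex splitting.  Vertices of the split graph are Fin (suc m):
-- `old a` (a : Fin m) is the old vertex a, except that the index of the
-- split vertex v is reused for v₁; the last vertex is v₂.
old : ∀ {m} → Fin (suc m) → Maybe (Fin m)
old {zero}  _       = nothing
old {suc m} zero    = just zero
old {suc m} (suc x) = M.map suc (old x)

splitAdj : ∀ {m} → Graph m → Fin m → (Fin m → Bool) → Fin (suc m) → Fin (suc m) → Bool
splitAdj {m} G₀ v side x y = go (old x) (old y)
  where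
  toV1 : Fin m → Bool
  toV1 u = adj G₀ v u ∧ side u
  toV2 : Fin m → Bool
  toV2 u = adj G₀ v u ∧ not (side u)
  go : Maybe _ → Maybe _ → Bool
  go (just a) (just b) with a ≟ v | b ≟ v
  ... | yes _ | yes _ = false
  ... | yes _ | no  _ = toV1 b
  ... | no  _ | yes _ = toV1 a
  ... | no  _ | no  _ = adj G₀ a b
  go (just a) nothing with a ≟ v
  ... | yes _ = true
  ... | no  _ = toV2 a
  go nothing (just b) with b ≟ v
  ... | yes _ = true
  ... | no  _ = toV2 b
  go nothing nothing = false

-- G is (isomorphic to) a graph obtained from G₀ by splitting some vertex v,
-- with N(v) partitioned into two nonempty parts (the sets {u₁..u_s}, {u_{s+1}..u_t}).
IsVertexSplitting : ∀ {m} → Graph m → Graph (suc m) → Set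
IsVertexSplitting {m} G₀ G =
  ∃ λ (v : Fin m) → ∃ λ (side : Fin m → Bool) →
    (∃ λ u → adj G₀ v u ∧ side u ≡ true) ×
    (∃ λ u → adj G₀ v u ∧ not (side u) ≡ true) ×
    (∃ λ (π : Permutation′ (suc m)) →
       ∀ x y → adj G (π ⟨$⟩ʳ x) (π ⟨$⟩ʳ y) ≡ splitAdj G₀ v side x y)

{-# OPTIONS --safe #-}
-- Encode a k-edge-colouring as k matchings that cover the edges, each matching being an involution of the
-- vertices. Let a, b be the two new vertices. A Δ-colouring of G₀ is a Δ-colouring of G − ab in which every colour
-- is missing at exactly one of a, b, while all other vertices have degree Δ. As n is odd, every colour of a
-- Δ-colouring of G would be missing somewhere, hence at a or b, which contradicts deg a + deg b = Δ + 2; so G has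
-- chromatic index Δ + 1. An edge az can be uncoloured instead of ab, as its colour is missing at b, so only an edge
-- xy avoiding a and b remains: assume that G − xy is not Δ-colourable, and uncolour xy in the colouring of G − ab.
-- Kempe chains show that x and y are not adjacent to a or b. If a and b both miss two colours, there is no path
-- bwx or awx (a Kierstead path abwx or bawx), so the neighbourhoods of a and b avoid that of x, which is impossible
-- for Δ ≥ 3(n − 1)/4. Otherwise, say, deg a = 2, with neighbours b and u; then x and y are not adjacent to u either,
-- and 4Δ ≥ 3(n − 1) forces a common neighbour w of u, b, x, y. Kempe changes lead to a colouring in which ab and wx
-- have the same colour c, only ua is uncoloured, u misses c, and x, y miss a colour d; let p and s be the colours of
-- wu and wy. Moving p from wu to ua and c from wx to wu leaves only wx uncoloured, so w and x are the ends of a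
-- (d, p)-chain. The (c, s)-chain that leaves x on the edge of colour s reaches at most one of u, b, w; in each case
-- it yields (for the pair b, u in place of u, b if it reaches u) a colouring with the same (d, p)-chains in which
-- only wy is uncoloured, so w and y are the ends of a (d, p)-chain as well: a contradiction.
module Submission where

open import Defs
open import Data.Nat using (ℕ; suc; _≤_; _*_)
open import Data.Nat using (zero; _<_; _+_; _⊔_; _^_; z≤n; s≤s)
open import Data.Nat.Properties hiding (_≟_; _<?_; <-cmp; <-asym)
open import Data.Nat.Tactic.RingSolver using (solve-∀)
open import Data.Bool using (Bool; true; false; not; _∧_; _∨_; if_then_else_)
open import Data.Bool.Properties using (¬-not; ∨-zeroʳ) renaming (_≟_ to _≟ᵇ_)
open import Data.Fin using (Fin; zero; suc; _≟_; inject₁; inject≤; fromℕ; finToFun; funToFin)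
open import Data.Fin.Permutation using (Permutation′; permutation; _⟨$⟩ʳ_; _⟨$⟩ˡ_; inverseˡ; inverseʳ)
open import Data.Fin.Permutation.Components using (transpose)
open import Data.Fin.Properties using (any?; all?; inject≤-injective; finToFun-funToFin; <-cmp; _<?_)
open import Data.List using (tabulate; foldr)
open import Data.List.Properties using (map-tabulate)
open import Data.Maybe using (Maybe; just; nothing)
open import Data.Maybe.Properties using (just-injective)
import Data.Nat.ListAction as List
open import Data.Product using (∃; _×_; _,_; proj₁; proj₂)
import Data.Sum as Sum
open import Data.Sum using (_⊎_; inj₁; inj₂)
open import Data.Empty using (⊥; ⊥-elim)
open import Function using (_∘_; id; mk⇔)
open import Relation.Nullary using (¬_; Dec; yes; no; does; contradiction)
open import Relation.Nullary.Decidable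
  using (dec-true; dec-false; _×-dec_; _⊎-dec_; _→-dec_; ¬?; decidable-stable; does-⇔; map′)
open import Relation.Binary.Definitions using (tri<; tri≈; tri>)
open import Relation.Binary.PropositionalEquality
  using (_≡_; _≢_; refl; trans; cong; cong₂; subst; ≢-sym; module ≡-Reasoning)
  renaming (sym to ≡-sym)
open import Algebra.Properties.CommutativeMonoid.Sum +-0-commutativeMonoid
  using (sum; sum-syntax; sum-cong-≗; ∑-distrib-+; ∑-comm; sum-permute; sum-init-last; sum-replicate-zero)

-- Monotonicity of finite sums

sum-mono-≤ : ∀ {n} (f g : Fin n → ℕ) → (∀ v → f v ≤ g v) → sum f ≤ sum g
sum-mono-≤ {zero}  f g f≤g = z≤n
sum-mono-≤ {suc n} f g f≤g = +-mono-≤ (f≤g zero) (sum-mono-≤ (f ∘ suc) (g ∘ suc) (f≤g ∘ suc))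

sum-mono-< : ∀ {n} (f g : Fin n → ℕ) → (∀ v → f v ≤ g v) → ∀ x → f x < g x → sum f < sum g
sum-mono-< {suc n} f g f≤g zero    fx<gx =
  +-mono-<-≤ fx<gx (sum-mono-≤ (f ∘ suc) (g ∘ suc) (f≤g ∘ suc))
sum-mono-< {suc n} f g f≤g (suc x) fx<gx =
  +-mono-≤-< (f≤g zero) (sum-mono-< (f ∘ suc) (g ∘ suc) (f≤g ∘ suc) x fx<gx)

-- Kempe chains of two involutions

module _ {n : ℕ} where

  Involutive : (Fin n → Fin n) → Set
  Involutive f = ∀ v → f (f v) ≡ v

  Closed : (Fin n → Fin n) → (Fin n → Bool) → Set
  Closed f T = ∀ v → T (f v) ≡ T v

  EndVertex : (f g : Fin n → Fin n) → Fin n → Set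
  EndVertex f g v = f v ≡ v ⊎ g v ≡ v

  moves : (Fin n → Fin n) → Fin n → ℕ
  moves f v = if does (f v ≟ v) then 0 else 1

  ⁅_⁆ : Fin n → Fin n → Bool
  ⁅ x ⁆ v = does (v ≟ x)

  ⁅⁆-refl : ∀ x → ⁅ x ⁆ x ≡ true
  ⁅⁆-refl x = dec-true (x ≟ x) refl

  ⁅⁆-≢ : ∀ {x v} → v ≢ x → ⁅ x ⁆ v ≡ false
  ⁅⁆-≢ {x} {v} = dec-false (v ≟ x)

  ⁅⁆⇒≡ : ∀ x v → ⁅ x ⁆ v ≡ true → v ≡ x
  ⁅⁆⇒≡ x v p with v ≟ x
  ... | yes v≡x = v≡x

  ⁅⁆-closed : ∀ f → Involutive f → ∀ {x} → f x ≡ x → Closed f ⁅ x ⁆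
  ⁅⁆-closed f f-inv {x} fx≡x v with v ≟ x
  ... | yes refl = dec-true (f v ≟ v) fx≡x
  ... | no v≢x   = dec-false (f v ≟ x)
        (λ fv≡x → v≢x (trans (≡-sym (f-inv v)) (trans (cong f fv≡x) fx≡x)))

  ∨-closed : ∀ f S T → Closed f S → Closed f T → Closed f (λ v → S v ∨ T v)
  ∨-closed _ _ _ S-closed T-closed v = cong₂ _∨_ (S-closed v) (T-closed v)

  cut : (Fin n → Fin n) → Fin n → Fin n → Fin n
  cut g p v with v ≟ p | v ≟ g p
  ... | yes _ | _     = v
  ... | no _  | yes _ = v
  ... | no _  | no _  = g v

  module _ (g : Fin n → Fin n) (p : Fin n) where

    cut-at : cut g p p ≡ p
    cut-at with p ≟ p | p ≟ g p
    ... | yes _  | _ = refl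
    ... | no p≢p | _ = contradiction refl p≢p

    cut-at-image : cut g p (g p) ≡ g p
    cut-at-image with g p ≟ p | g p ≟ g p
    ... | yes _ | _      = refl
    ... | no _  | yes _  = refl
    ... | no _  | no neq = contradiction refl neq

    cut-other : ∀ {v} → v ≢ p → v ≢ g p → cut g p v ≡ g v
    cut-other {v} v≢p v≢gp with v ≟ p | v ≟ g p
    ... | yes v≡p | _        = contradiction v≡p v≢p
    ... | no _    | yes v≡gp = contradiction v≡gp v≢gp
    ... | no _    | no _     = refl

    cut-fixed : ∀ {v} → g v ≡ v → cut g p v ≡ v
    cut-fixed {v} gv≡v with v ≟ p | v ≟ g p
    ... | yes _ | _     = refl
    ... | no _  | yes _ = refl
    ... | no _  | no _  = gv≡v

    cut-involutive : Involutive g → Involutive (cut g p)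
    cut-involutive g-inv v with v ≟ p | v ≟ g p
    ... | yes refl | _        = cut-at
    ... | no _     | yes refl = cut-at-image
    ... | no v≢p   | no v≢gp  = trans (cut-other gv≢p gv≢gp) (g-inv v)
      where
      gv≢p : g v ≢ p
      gv≢p gv≡p = v≢gp (trans (≡-sym (g-inv v)) (cong g gv≡p))
      gv≢gp : g v ≢ g p
      gv≢gp gv≡gp = v≢p (trans (≡-sym (g-inv v)) (trans (cong g gv≡gp) (g-inv p)))

    moves-cut≤ : ∀ v → moves (cut g p) v ≤ moves g v
    moves-cut≤ v with g v ≟ v
    ... | yes gv≡v rewrite dec-true (cut g p v ≟ v) (cut-fixed gv≡v) = z≤n
    ... | no _ with cut g p v ≟ v
    ...   | yes _ = z≤n
    ...   | no _  = ≤-refl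

    moves-cut< : g p ≢ p → sum (moves (cut g p)) < sum (moves g)
    moves-cut< gp≢p = sum-mono-< _ _ moves-cut≤ p strict
      where
      strict : moves (cut g p) p < moves g p
      strict rewrite dec-true (cut g p p ≟ p) cut-at | dec-false (g p ≟ p) gp≢p = s≤s z≤n

  -- When `f` fixes `x`, the component of `x` in the union of the two matchings is a path. Only what
  -- Kempe changes need is recorded: a closed set around `x` in which at most one other vertex
  -- misses one of the two colours.
  Chain : (f g : Fin n → Fin n) → Fin n → Set
  Chain f g x = ∃ λ T → Closed f T × Closed g T × T x ≡ true ×
    (∀ y z → y ≢ x → z ≢ x → EndVertex f g y → EndVertex f g z →
      T y ≡ true → T z ≡ true → y ≡ z)

  -- The path is walked edge by edge: from `x` to `g x`, then onwards from `g x` with the roles of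
  -- `f` and `g` exchanged. Cutting the traversed edge out of `g` makes `g x` a fixed point, as the
  -- recursive call demands, and lowers the number of moved points, which bounds the recursion.
  chain-fuelled : ∀ N f g → sum (moves f) + sum (moves g) < N →
    Involutive f → Involutive g → ∀ x → f x ≡ x → Chain f g x
  chain-fuelled (suc N) f g bound f-inv g-inv x fx≡x with g x ≟ x
  ... | yes gx≡x = ⁅ x ⁆ , ⁅⁆-closed f f-inv fx≡x , ⁅⁆-closed g g-inv gx≡x , ⁅⁆-refl x ,
          λ y z y≢x _ _ _ y∈ _ → contradiction (⁅⁆⇒≡ x y y∈) y≢x
  -- Uniqueness in the recursive call exempts its own start `g x`, so it transfers only if `g x` is
  -- not an end vertex. A chain that stops at `g x` is therefore given outright as the pair `x`,
  -- `g x`.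
  ... | no gx≢x with f (g x) ≟ g x
  ...   | yes fgx≡gx = T , ∨-closed f ⁅ x ⁆ ⁅ g x ⁆ (⁅⁆-closed f f-inv fx≡x) (⁅⁆-closed f f-inv fgx≡gx) , g-closed ,
            cong (_∨ ⁅ g x ⁆ x) (⁅⁆-refl x) ,
            λ y z y≢x z≢x _ _ y∈ z∈ → trans (T⇒≡ y y≢x y∈) (≡-sym (T⇒≡ z z≢x z∈))
    where
    T : Fin n → Bool
    T v = ⁅ x ⁆ v ∨ ⁅ g x ⁆ v
    T⇒≡ : ∀ y → y ≢ x → T y ≡ true → y ≡ g x
    T⇒≡ y y≢x y∈ rewrite ⁅⁆-≢ y≢x = ⁅⁆⇒≡ (g x) y y∈
    g-closed : Closed g T
    g-closed v with v ≟ x | v ≟ g x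
    ... | yes refl | _ rewrite ⁅⁆-refl (g v) = ∨-zeroʳ _
    ... | no _ | yes refl rewrite g-inv x | ⁅⁆-refl x = refl
    ... | no v≢x | no v≢gx
      rewrite ⁅⁆-≢ {x} {g v} (λ e → v≢gx (trans (≡-sym (g-inv v)) (cong g e)))
            | ⁅⁆-≢ {g x} {g v} (λ e → v≢x (trans (≡-sym (g-inv v)) (trans (cong g e) (g-inv x)))) = refl
  ...   | no fgx≢gx = extend (chain-fuelled N (cut g x) f bound′ (cut-involutive g x g-inv) f-inv
                               (g x) (cut-at-image g x))
    where
    bound′ : sum (moves (cut g x)) + sum (moves f) < N
    bound′ = <-≤-trans (+-mono-<-≤ (moves-cut< g x gx≢x) ≤-refl)
               (≤-pred (subst (_< suc N) (+-comm (sum (moves f)) (sum (moves g))) bound))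
    extend : Chain (cut g x) f (g x) → Chain f g x
    extend (S , S-cut , S-f , gx∈S , unique) =
      T , ∨-closed f ⁅ x ⁆ S (⁅⁆-closed f f-inv fx≡x) S-f , g-closed , cong (_∨ S x) (⁅⁆-refl x) ,
      λ y z y≢x z≢x y-end z-end y∈ z∈ →
        unique y z (≢gx y-end) (≢gx z-end) (end y-end) (end z-end) (inS y≢x y∈) (inS z≢x z∈)
      where
      T : Fin n → Bool
      T v = ⁅ x ⁆ v ∨ S v
      inS : ∀ {y} → y ≢ x → T y ≡ true → S y ≡ true
      inS y≢x y∈ rewrite ⁅⁆-≢ y≢x = y∈
      ≢gx : ∀ {y} → EndVertex f g y → y ≢ g x
      ≢gx (inj₁ fy≡y) refl = fgx≢gx fy≡y
      ≢gx (inj₂ gy≡y) refl = gx≢x (trans (≡-sym gy≡y) (g-inv x))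
      end : ∀ {y} → EndVertex f g y → EndVertex (cut g x) f y
      end (inj₁ fy≡y) = inj₂ fy≡y
      end (inj₂ gy≡y) = inj₁ (cut-fixed g x gy≡y)
      g-closed : Closed g T
      g-closed v with v ≟ x
      ... | yes refl rewrite gx∈S = ∨-zeroʳ _
      ... | no v≢x with v ≟ g x
      ...   | yes refl rewrite g-inv x | ⁅⁆-refl x = ≡-sym gx∈S
      ...   | no v≢gx
        rewrite ⁅⁆-≢ {x} {g v} (λ e → v≢gx (trans (≡-sym (g-inv v)) (cong g e))) =
          trans (cong S (≡-sym (cut-other g x v≢x v≢gx))) (S-cut v)

  chain : ∀ f g → Involutive f → Involutive g → ∀ x → f x ≡ x → Chain f g x
  chain f g = chain-fuelled _ f g (n<1+n _)

-- Transpositions of colours, matchings and uncovered edges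

module _ {k} (i j : Fin k) where

  transpose-at-l : transpose i j i ≡ j
  transpose-at-l rewrite dec-true (i ≟ i) refl = refl

  transpose-at-r : transpose i j j ≡ i
  transpose-at-r with j ≟ i
  ... | yes j≡i = j≡i
  ... | no _ rewrite dec-true (j ≟ j) refl = refl

  transpose-other : ∀ {c} → c ≢ i → c ≢ j → transpose i j c ≡ c
  transpose-other {c} c≢i c≢j rewrite dec-false (c ≟ i) c≢i | dec-false (c ≟ j) c≢j = refl

  transpose-involutive : ∀ c → transpose i j (transpose i j c) ≡ c
  transpose-involutive c with c ≟ i
  ... | yes refl = transpose-at-r
  ... | no c≢i with c ≟ j
  ...   | yes refl = transpose-at-l
  ...   | no c≢j = transpose-other c≢i c≢j

-- The i-th colour class is the matching formed by the pairs v, mate i v with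
-- mate i v ≢ v.
record Matchings (k n : ℕ) : Set where
  field
    mate            : Fin k → Fin n → Fin n
    mate-involutive : ∀ i → Involutive (mate i)

open Matchings public

module _ {k n : ℕ} (M : Matchings k n) where

  Misses : Fin k → Fin n → Set
  Misses i v = mate M i v ≡ v

  Covered : Fin n → Fin n → Set
  Covered u v = ∃ λ i → mate M i u ≡ v

  mate-flip : ∀ {i u v} → mate M i u ≡ v → mate M i v ≡ u
  mate-flip {i} {u} refl = mate-involutive M i u

Pair : ∀ {n} (p q u v : Fin n) → Set
Pair p q u v = (u ≡ p × v ≡ q) ⊎ (u ≡ q × v ≡ p)

-- An edge may be covered by several matchings and the matchings may contain
-- non-edges: a graph is k-edge-colourable as soon as k matchings cover its edges.
Covers : ∀ {k n} → Graph n → Matchings k n → Set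
Covers H M = ∀ u v → adj H u v ≡ true → Covered M u v

CoversBut : ∀ {k n} → Graph n → Matchings k n → Fin n → Fin n → Set
CoversBut H M p q = ∀ u v → adj H u v ≡ true → Covered M u v ⊎ Pair p q u v

coversBut-sym : ∀ {k n} (H : Graph n) (M : Matchings k n) {p q} → CoversBut H M p q → CoversBut H M q p
coversBut-sym H M cov u v uv with cov u v uv
... | inj₁ c        = inj₁ c
... | inj₂ (inj₁ e) = inj₂ (inj₂ e)
... | inj₂ (inj₂ e) = inj₂ (inj₁ e)

adjacent⇒≢ : ∀ {n} (H : Graph n) {u v} → adj H u v ≡ true → u ≢ v
adjacent⇒≢ H {u} uv refl with trans (≡-sym uv) (irrefl H u)
... | ()

adj-flip : ∀ {n} (H : Graph n) {u v} → adj H u v ≡ true → adj H v u ≡ true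
adj-flip H {u} {v} uv = trans (sym H v u) uv

true≢false : true ≢ false
true≢false ()

-- Kempe changes and exchanges inside one colour class

module _ {k n : ℕ} (M : Matchings k n) where

  -- A Kempe change. Closedness is all it needs, so `T` may be one chain, several chains or the
  -- complement of a chain.
  module Swap (i j : Fin k) (T : Fin n → Bool)
              (Ti : Closed (mate M i) T) (Tj : Closed (mate M j) T) where

    private
      τ : Fin k → Fin k
      τ = transpose i j

      swapped : Fin k → Fin n → Fin n
      swapped c v = mate M (if T v then τ c else c) v

      -- The swapped matchings are involutive for two different reasons: for `i` and `j` because a
      -- vertex and its mate lie on the same side of `T`, for the other colours because the side
      -- does not matter.
      T-mate : ∀ c v → T (mate M (if T v then τ c else c) v) ≡ T v ⊎ τ c ≡ c
      T-mate c v = by-colour (c ≟ i) (c ≟ j)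
        where
        by-side : ∀ {d} → τ c ≡ d → Closed (mate M c) T → Closed (mate M d) T →
                  ∀ t → T (mate M (if t then τ c else c) v) ≡ T v
        by-side refl Tc Td true  = Td v
        by-side refl Tc Td false = Tc v
        by-colour : Dec (c ≡ i) → Dec (c ≡ j) → T (mate M (if T v then τ c else c) v) ≡ T v ⊎ τ c ≡ c
        by-colour (yes refl) _          = inj₁ (by-side (transpose-at-l i j) Ti Tj (T v))
        by-colour (no _)     (yes refl) = inj₁ (by-side (transpose-at-r i j) Tj Ti (T v))
        by-colour (no c≢i)   (no c≢j)   = inj₂ (transpose-other i j c≢i c≢j)

      unchanged : ∀ {c} → τ c ≡ c → ∀ t → (if t then τ c else c) ≡ c
      unchanged τc≡c true  = τc≡c
      unchanged τc≡c false = refl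

      swapped-involutive : ∀ c → Involutive (swapped c)
      swapped-involutive c v with T-mate c v
      ... | inj₁ same rewrite same = mate-involutive M _ v
      ... | inj₂ τc≡c
        rewrite unchanged τc≡c (T v) | unchanged τc≡c (T (mate M c v)) = mate-involutive M c v

    swap : Matchings k n
    swap = record { mate = swapped ; mate-involutive = swapped-involutive }

    swap-on : ∀ {v} → T v ≡ true → ∀ c → mate swap c v ≡ mate M (τ c) v
    swap-on v∈T c rewrite v∈T = refl

    swap-off : ∀ {v} → T v ≡ false → ∀ c → mate swap c v ≡ mate M c v
    swap-off v∉T c rewrite v∉T = refl

    swap-other : ∀ {c} → c ≢ i → c ≢ j → ∀ v → mate swap c v ≡ mate M c v
    swap-other c≢i c≢j v = cong (λ d → mate M d v) (unchanged (transpose-other i j c≢i c≢j) (T v))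

    swap-covered : ∀ {u v} → Covered M u v → Covered swap u v
    swap-covered {u} (c , e) with T u
    ... | false = c , e
    ... | true  = τ c , trans (cong (λ d → mate M d u) (transpose-involutive i j c)) e

    swap-coversBut : ∀ H {p q} → CoversBut H M p q → CoversBut H swap p q
    swap-coversBut H cov u v uv with cov u v uv
    ... | inj₁ c = inj₁ (swap-covered c)
    ... | inj₂ e = inj₂ e

  module Replace (i : Fin k) (f : Fin n → Fin n) (f-inv : Involutive f) where

    private
      replaced : Fin k → Fin n → Fin n
      replaced c with c ≟ i
      ... | yes _ = f
      ... | no _  = mate M c

      replaced-involutive : ∀ c → Involutive (replaced c)
      replaced-involutive c with c ≟ i
      ... | yes _ = f-inv
      ... | no _  = mate-involutive M c

    replace : Matchings k n
    replace = record { mate = replaced ; mate-involutive = replaced-involutive }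

    replace-at : ∀ v → mate replace i v ≡ f v
    replace-at v with i ≟ i
    ... | yes _  = refl
    ... | no neq = contradiction refl neq

    replace-other : ∀ {c} → c ≢ i → ∀ v → mate replace c v ≡ mate M c v
    replace-other {c} c≢i v with c ≟ i
    ... | yes c≡i = contradiction c≡i c≢i
    ... | no _    = refl

-- Exchanges the edge from u to g u for an edge from u to a; if g u ≡ u, no edge is lost.
slide : ∀ {n} → (Fin n → Fin n) → Fin n → Fin n → Fin n → Fin n
slide g u a v with v ≟ u | v ≟ a | v ≟ g u
... | yes _ | _     | _     = a
... | no _  | yes _ | _     = u
... | no _  | no _  | yes _ = v
... | no _  | no _  | no _  = g v

module _ {n : ℕ} (g : Fin n → Fin n) (u a : Fin n) where

  slide-at : slide g u a u ≡ a
  slide-at with u ≟ u | u ≟ a | u ≟ g u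
  ... | yes _ | _ | _ = refl
  ... | no ne | _ | _ = contradiction refl ne

  slide-target : u ≢ a → slide g u a a ≡ u
  slide-target u≢a with a ≟ u | a ≟ a | a ≟ g u
  ... | yes a≡u | _    | _ = contradiction (≡-sym a≡u) u≢a
  ... | no _  | yes _ | _ = refl
  ... | no _  | no ne | _ = contradiction refl ne

  slide-freed : g u ≢ u → g u ≢ a → slide g u a (g u) ≡ g u
  slide-freed w≢u w≢a with g u ≟ u | g u ≟ a | g u ≟ g u
  ... | yes e | _     | _     = contradiction e w≢u
  ... | no _  | yes e | _     = contradiction e w≢a
  ... | no _  | no _  | yes _ = refl
  ... | no _  | no _  | no ne = contradiction refl ne

  slide-other : ∀ {v} → v ≢ u → v ≢ a → v ≢ g u → slide g u a v ≡ g v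
  slide-other {v} v≢u v≢a v≢w with v ≟ u | v ≟ a | v ≟ g u
  ... | yes e | _     | _     = contradiction e v≢u
  ... | no _  | yes e | _     = contradiction e v≢a
  ... | no _  | no _  | yes e = contradiction e v≢w
  ... | no _  | no _  | no _  = refl

  slide-fixed : ∀ {v} → v ≢ u → v ≢ a → g v ≡ v → slide g u a v ≡ v
  slide-fixed {v} v≢u v≢a gv≡v with v ≟ u | v ≟ a | v ≟ g u
  ... | yes e | _     | _     = contradiction e v≢u
  ... | no _  | yes e | _     = contradiction e v≢a
  ... | no _  | no _  | yes _ = refl
  ... | no _  | no _  | no _  = gv≡v

  slide-involutive : Involutive g → g a ≡ a → u ≢ a → Involutive (slide g u a)
  slide-involutive g-inv ga≡a u≢a v with v ≟ u | v ≟ a | v ≟ g u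
  ... | yes refl | _        | _        = slide-target u≢a
  ... | no _     | yes refl | _        = slide-at
  ... | no w≢u   | no w≢a   | yes refl = slide-freed w≢u w≢a
  ... | no v≢u   | no v≢a   | no v≢w   = trans (slide-other gv≢u gv≢a gv≢w) (g-inv v)
    where
    gv≢u : g v ≢ u
    gv≢u e = v≢w (trans (≡-sym (g-inv v)) (cong g e))
    gv≢a : g v ≢ a
    gv≢a e = v≢a (trans (≡-sym (g-inv v)) (trans (cong g e) ga≡a))
    gv≢w : g v ≢ g u
    gv≢w e = v≢u (trans (≡-sym (g-inv v)) (trans (cong g e) (g-inv u)))

slide-cong : ∀ {n} {f g : Fin n → Fin n} → (∀ v → f v ≡ g v) → ∀ u a v → slide f u a v ≡ slide g u a v
slide-cong {f = f} {g} f≗g u a v with v ≟ u | v ≟ a | v ≟ f u | v ≟ g u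
... | yes _ | _     | _     | _     = refl
... | no _  | yes _ | _     | _     = refl
... | no _  | no _  | yes _ | yes _ = refl
... | no _  | no _  | no _  | no _  = f≗g v
... | no _  | no _  | yes e | no ne = contradiction (trans e (f≗g u)) ne
... | no _  | no _  | no ne | yes e = contradiction (trans e (≡-sym (f≗g u))) ne

module SlideColour {k n : ℕ} (M : Matchings k n) {i : Fin k} {u a : Fin n}
                   (u≢a : u ≢ a) (a-misses : Misses M i a) where

  open Replace M i (slide (mate M i) u a)
    (slide-involutive (mate M i) u a (mate-involutive M i) a-misses u≢a) public
    renaming (replace to slideColour; replace-at to slideColour-at; replace-other to slideColour-other)

  -- The colour `i` leaves its edge at `u` for ua, so the uncovered edge rotates about `u`. If `u`
  -- misses `i` as well, then `mate M i u` is `u` itself, the exempt pair is a loop, and every edge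
  -- is covered.
  slideColour-coversBut : ∀ H → CoversBut H M u a → CoversBut H slideColour u (mate M i u)
  slideColour-coversBut H cov s t st with cov s t st
  ... | inj₂ (inj₁ (refl , refl)) = inj₁ (i , trans (slideColour-at s) (slide-at (mate M i) u a))
  ... | inj₂ (inj₂ (refl , refl)) = inj₁ (i , trans (slideColour-at s) (slide-target (mate M i) u a u≢a))
  ... | inj₁ (c , e) with c ≟ i
  ...   | no c≢i = inj₁ (c , trans (slideColour-other c≢i s) e)
  ...   | yes refl with s ≟ u | s ≟ mate M i u
  ...     | yes refl | _        = inj₂ (inj₁ (refl , ≡-sym e))
  ...     | no _     | yes refl = inj₂ (inj₂ (refl , trans (≡-sym e) (mate-involutive M i u)))
  ...     | no s≢u   | no s≢w   =
            inj₁ (i , trans (slideColour-at s) (trans (slide-other (mate M i) u a s≢u s≢a s≢w) e))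
    where
    s≢a : s ≢ a
    s≢a refl = adjacent⇒≢ H st (trans (≡-sym a-misses) e)

-- Missing colours at the ends of the only uncovered edge

module Uncoverable {k n : ℕ} (H : Graph n) (uncoverable : ∀ (M : Matchings k n) → ¬ Covers H M) where

  -- A colour missing at both ends could be given to pq, which would complete the covering.
  no-common-miss : ∀ (M : Matchings k n) {p q i} → p ≢ q → CoversBut H M p q →
    Misses M i p → Misses M i q → ⊥
  no-common-miss M {p} {q} {i} p≢q cov p-misses q-misses =
    uncoverable slideColour covers
    where
    open SlideColour M p≢q q-misses
    covers : Covers H slideColour
    covers u v uv with slideColour-coversBut H cov u v uv
    ... | inj₁ c               = c
    ... | inj₂ (inj₁ (eu , ev)) = contradiction (trans eu (≡-sym (trans ev p-misses))) (adjacent⇒≢ H uv)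
    ... | inj₂ (inj₂ (eu , ev)) = contradiction (trans (trans eu p-misses) (≡-sym ev)) (adjacent⇒≢ H uv)

  -- If `T` separated `p` from `q`, swapping `i` and `j` on `T` would leave both ends with a common
  -- missing colour. Applied to a chain, this says that the (i, j)-chain from `p` ends at `q`.
  linked : ∀ (M : Matchings k n) {p q i j} → p ≢ q → CoversBut H M p q →
    Misses M i p → Misses M j q → ∀ T → Closed (mate M i) T → Closed (mate M j) T → T p ≡ T q
  linked M {p} {q} {i} {j} p≢q cov p-misses q-misses T Ti Tj with T p in Tp | T q in Tq
  ... | true  | true  = refl
  ... | false | false = refl
  ... | true  | false = ⊥-elim (no-common-miss swap {i = j} p≢q (swap-coversBut H cov)
          (trans (swap-on Tp j) (trans (cong (λ c → mate M c p) (transpose-at-r i j)) p-misses))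
          (trans (swap-off Tq j) q-misses))
    where open Swap M i j T Ti Tj
  ... | false | true  = ⊥-elim (no-common-miss swap {i = i} p≢q (swap-coversBut H cov)
          (trans (swap-off Tp i) p-misses)
          (trans (swap-on Tq i) (trans (cong (λ c → mate M c q) (transpose-at-l i j)) q-misses)))
    where open Swap M i j T Ti Tj

  module _ (M : Matchings k n) {p q i j} (p≢q : p ≢ q) (cov : CoversBut H M p q)
           (p-misses : Misses M i p) (q-misses : Misses M j q) where

    linking-chain : ∃ λ T → Closed (mate M i) T × Closed (mate M j) T × T p ≡ true × T q ≡ true ×
      (∀ z → z ≢ p → z ≢ q → EndVertex (mate M i) (mate M j) z → T z ≡ false)
    linking-chain with chain (mate M i) (mate M j) (mate-involutive M i) (mate-involutive M j) p p-misses
    ... | T , Ti , Tj , p∈T , unique = T , Ti , Tj , p∈T , q∈T ,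
            λ z z≢p z≢q z-end → ¬-not
              (λ z∈T → z≢q (unique z q z≢p (≢-sym p≢q) z-end (inj₂ q-misses) z∈T q∈T))
      where
      q∈T : T q ≡ true
      q∈T = trans (≡-sym (linked M p≢q cov p-misses q-misses T Ti Tj)) p∈T

    -- The change is made off the chain from `p` to `q`. No other vertex missing `i` or `j` lies on
    -- that chain, so all of these are recoloured while `p` and `q` keep their colours.
    swap-away : ∃ λ M′ → CoversBut H M′ p q ×
      (∀ c → mate M′ c p ≡ mate M c p) × (∀ c → mate M′ c q ≡ mate M c q) ×
      (∀ {c} → c ≢ i → c ≢ j → ∀ z → mate M′ c z ≡ mate M c z) ×
      (∀ {z} → z ≢ p → z ≢ q → EndVertex (mate M i) (mate M j) z →
         ∀ c → mate M′ c z ≡ mate M (transpose i j c) z)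
    swap-away with linking-chain
    ... | T , Ti , Tj , p∈T , q∈T , ends =
      swap , swap-coversBut H cov , swap-off (cong not p∈T) , swap-off (cong not q∈T) , swap-other ,
      λ {z} z≢p z≢q z-end → swap-on (cong not (ends z z≢p z≢q z-end))
      where open Swap M i j (not ∘ T) (cong not ∘ Ti) (cong not ∘ Tj)

-- Kierstead paths

-- For the two new vertices: their edges other than ab stem from edges at one vertex of the unsplit
-- graph, so no colour is present at both.
Total : ∀ {k n} → Matchings k n → Fin n → Fin n → Set
Total M a b = ∀ i → Misses M i a ⊎ Misses M i b

Total-transport : ∀ {k n} {M M′ : Matchings k n} {a b} →
  (∀ c → mate M′ c a ≡ mate M c a) → (∀ c → mate M′ c b ≡ mate M c b) → Total M a b → Total M′ a b
Total-transport at-a at-b total i with total i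
... | inj₁ e = inj₁ (trans (at-a i) e)
... | inj₂ e = inj₂ (trans (at-b i) e)

module Adjacency {k n : ℕ} (H : Graph n) (uncoverable : ∀ (M : Matchings k n) → ¬ Covers H M) where

  open Uncoverable H uncoverable public

  module _ {a b x : Fin n} (a≢b : a ≢ b) (x≢a : x ≢ a) (x≢b : x ≢ b) where

    private
      b≢a : b ≢ a
      b≢a = ≢-sym a≢b

    -- The (α, γ)-chain from `b` has to end at `a`, but its first edge leads to `x`, which misses
    -- `α` and stops it.
    no-chain-to : ∀ (M : Matchings k n) {γ α} → CoversBut H M a b →
      Misses M γ a → Misses M α b → Misses M α x → mate M γ b ≢ x
    no-chain-to M cov γa αb αx γbx with linking-chain M b≢a (coversBut-sym H M cov) αb γa
    ... | T , Tα , Tγ , b∈T , _ , ends = true≢false (trans (≡-sym x∈T) (ends x x≢b x≢a (inj₁ αx)))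
      where
      x∈T : T x ≡ true
      x∈T = trans (cong T (≡-sym γbx)) (trans (Tγ b) b∈T)

    -- The colour `γ` of bx is present at `b`, hence missing at `a`. If `α` is missing at `a` rather
    -- than at `b`, a Kempe change off the chain from `b` to `a` first makes `x` miss `β` instead;
    -- then `no-chain-to` applies.
    nonadjacent : ∀ (M : Matchings k n) {α β} → CoversBut H M a b → Total M a b →
      Misses M β b → Misses M α x → adj H b x ≢ true
    nonadjacent M {α} {β} cov total βb αx bx with cov b x bx
    ... | inj₂ (inj₁ (b≡a , _)) = b≢a b≡a
    ... | inj₂ (inj₂ (_ , x≡a)) = x≢a x≡a
    ... | inj₁ (γ , γbx) with total γ
    ...   | inj₂ γb = x≢b (trans (≡-sym γbx) γb)
    ...   | inj₁ γa with total α
    ...     | inj₂ αb = no-chain-to M cov γa αb αx γbx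
    ...     | inj₁ αa with swap-away M b≢a (coversBut-sym H M cov) βb αa
    ...       | M′ , cov′ , at-b , at-a , _ , ends =
      no-chain-to M′ (coversBut-sym H M′ cov′) (trans (at-a γ) γa) (trans (at-b β) βb)
        (trans (ends x≢b x≢a (inj₂ αx) β) (trans (cong (λ c → mate M c x) (transpose-at-l β α)) αx))
        (trans (at-b γ) γbx)

    module _ {w : Fin n} (w≢a : w ≢ a) (w≢b : w ≢ b) (x≢w : x ≢ w) where

      -- Together with an edge wx this is a Kierstead path `a`, `b`, `w`, `x` whose first edge is
      -- the uncovered one. Of the two colours missing at `b`, at least one differs from the colour
      -- of wx.
      record Setting (M : Matchings k n) : Set where
        field
          covers      : CoversBut H M b a
          total       : Total M a b
          {α₁ α₂ β}   : Fin k
          α₁≢α₂       : α₁ ≢ α₂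
          α₁-misses-b : Misses M α₁ b
          α₂-misses-b : Misses M α₂ b
          β-colours   : mate M β b ≡ w

        β-misses-a : Misses M β a
        β-misses-a with total β
        ... | inj₁ βa = βa
        ... | inj₂ βb = contradiction (trans (≡-sym β-colours) βb) w≢b

      open Setting

      transport : ∀ {M M′} → (S : Setting M) → CoversBut H M′ b a →
        (∀ c → mate M′ c b ≡ mate M c b) → (∀ c → mate M′ c a ≡ mate M c a) → Setting M′
      transport {M} {M′} S cov′ at-b at-a = record
        { covers = cov′ ; total = Total-transport {M = M} {M′} at-a at-b (total S) ; α₁≢α₂ = α₁≢α₂ S
        ; α₁-misses-b = trans (at-b _) (α₁-misses-b S) ; α₂-misses-b = trans (at-b _) (α₂-misses-b S)
        ; β-colours = trans (at-b _) (β-colours S) }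

      -- In this block wx is an edge of colour γ.
      private
        γ≢missing : ∀ (M : Matchings k n) {γ α} → mate M γ w ≡ x → Misses M α x → γ ≢ α
        γ≢missing M γwx αx refl = x≢w (trans (≡-sym αx) (mate-flip M γwx))

        γ≢β : ∀ {M} (S : Setting M) {γ} → mate M γ w ≡ x → γ ≢ β S
        γ≢β {M} S γwx refl = x≢b (trans (≡-sym γwx) (mate-flip M (β-colours S)))

        -- The (γ, β)-chain from `b` runs through `w` to `x` and would stop there instead of
        -- reaching `a`.
        missing-β : ∀ {M} (S : Setting M) {γ} → Misses M γ b → mate M γ w ≡ x → ¬ Misses M (β S) x
        missing-β {M} S γb γwx βx with linking-chain M b≢a (covers S) γb (β-misses-a S)
        ... | T , Tγ , Tβ , b∈T , _ , ends = true≢false (trans (≡-sym x∈T) (ends x x≢b x≢a (inj₂ βx)))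
          where
          x∈T : T x ≡ true
          x∈T = trans (cong T (≡-sym γwx)) (trans (Tγ w)
                  (trans (cong T (≡-sym (β-colours S))) (trans (Tβ b) b∈T)))

        -- A Kempe change of `α` and `β` off the chain from `b` to `a` makes `x` miss `β` and leaves
        -- the colours of bw and wx alone, which is the case of `missing-β`.
        missing-at-b : ∀ {M} (S : Setting M) {γ α} → Misses M γ b → mate M γ w ≡ x →
          Misses M α b → ¬ Misses M α x
        missing-at-b {M} S {γ} {α} γb γwx αb αx
          with swap-away M b≢a (covers S) αb (β-misses-a S)
        ... | M′ , cov′ , at-b , at-a , other , ends =
          missing-β (transport {M} {M′} S cov′ at-b at-a) (trans (at-b γ) γb)
            (trans (other (γ≢missing M γwx αx) (γ≢β S γwx) w) γwx)
            (trans (ends x≢b x≢a (inj₁ αx) (β S))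
              (trans (cong (λ c → mate M c x) (transpose-at-r α (β S))) αx))

        another : ∀ {M} (S : Setting M) γ → ∃ λ α → α ≢ γ × Misses M α b
        another S γ with α₁ S ≟ γ
        ... | no α₁≢γ  = α₁ S , α₁≢γ , α₁-misses-b S
        ... | yes refl = α₂ S , ≢-sym (α₁≢α₂ S) , α₂-misses-b S

        replace-missing : ∀ {M} (S : Setting M) {γ α α′} → mate M γ w ≡ x → Misses M α a → Misses M α x →
          Misses M α′ b → γ ≢ α′ →
          ∃ λ M′ → Setting M′ × (∀ c → mate M′ c b ≡ mate M c b) × (∀ c → mate M′ c a ≡ mate M c a) ×
            Misses M′ α′ x × mate M′ γ w ≡ x
        replace-missing {M} S {γ} {α} {α′} γwx αa αx α′b γ≢α′
          with swap-away M b≢a (covers S) α′b αa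
        ... | M′ , cov′ , at-b , at-a , other , ends =
          M′ , transport {M} {M′} S cov′ at-b at-a , at-b , at-a ,
          trans (ends x≢b x≢a (inj₂ αx) α′) (trans (cong (λ c → mate M c x) (transpose-at-l α′ α)) αx) ,
          trans (other γ≢α′ (γ≢missing M γwx αx) w) γwx

        -- If `α` is missing at `a`, it is first exchanged at `x` for a colour missing at `b`; this
        -- one has to differ from `γ` for wx to keep its colour.
        γ-missing-at-b : ∀ {M} (S : Setting M) {γ α} → Misses M γ b → mate M γ w ≡ x → ¬ Misses M α x
        γ-missing-at-b {M} S {γ} {α} γb γwx αx with total S α | another S γ
        ... | inj₂ αb | _ = missing-at-b S γb γwx αb αx
        ... | inj₁ αa | α′ , α′≢γ , α′b with replace-missing S γwx αa αx α′b (≢-sym α′≢γ)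
        ...   | M′ , S′ , at-b , at-a , α′x , γwx′ =
          missing-at-b S′ (trans (at-b γ) γb) γwx′ (trans (at-b α′) α′b) α′x

        -- A Kempe change of `α` and `γ` off the chain from `b` to `a` recolours wx with `α`. Now
        -- the colour of wx is missing at `b` and `x` misses `γ`, so `γ-missing-at-b` applies.
        γ-missing-at-a : ∀ {M} (S : Setting M) {γ α} → Misses M γ a → mate M γ w ≡ x →
          Misses M α b → ¬ Misses M α x
        γ-missing-at-a {M} S {γ} {α} γa γwx αb αx with swap-away M b≢a (covers S) αb γa
        ... | M′ , cov′ , at-b , at-a , other , ends =
          γ-missing-at-b (transport {M} {M′} S cov′ at-b at-a) (trans (at-b α) αb)
            (mate-flip M′ (trans (ends x≢b x≢a (inj₁ αx) α)
              (trans (cong (λ c → mate M c x) (transpose-at-l α γ)) (mate-flip M γwx))))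
            (trans (ends x≢b x≢a (inj₁ αx) γ) (trans (cong (λ c → mate M c x) (transpose-at-r α γ)) αx))

      no-kierstead-path : ∀ {M} → Setting M → adj H w x ≡ true → ∀ {α} → ¬ Misses M α x
      no-kierstead-path {M} S wx {α} αx with covers S w x wx
      ... | inj₂ (inj₁ (w≡b , _)) = w≢b w≡b
      ... | inj₂ (inj₂ (w≡a , _)) = w≢a w≡a
      ... | inj₁ (γ , γwx) with total S γ
      ...   | inj₂ γb = γ-missing-at-b S γb γwx αx
      ...   | inj₁ γa with total S α
      ...     | inj₂ αb = γ-missing-at-a S γa γwx αb αx
      -- The colour missing at `x` is traded for `α₁ S`. This is not the colour of wx, because `a`
      -- and `b` have no common missing colour.
      ...     | inj₁ αa
        with replace-missing S γwx αa αx (α₁-misses-b S) γ≢α₁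
        where
        γ≢α₁ : γ ≢ α₁ S
        γ≢α₁ refl = no-common-miss M b≢a (covers S) (α₁-misses-b S) γa
      ...       | M′ , S′ , at-b , at-a , α₁x , γwx′ =
        γ-missing-at-a S′ (trans (at-a γ) γa) γwx′ (trans (at-b (α₁ S)) (α₁-misses-b S)) α₁x

-- A new vertex of degree two

override : ∀ {n} → Fin n → Bool → (Fin n → Bool) → Fin n → Bool
override a t S v = if does (v ≟ a) then t else S v

module _ {n : ℕ} (a : Fin n) (t : Bool) (S : Fin n → Bool) where

  override-at : override a t S a ≡ t
  override-at rewrite dec-true (a ≟ a) refl = refl

  override-other : ∀ {v} → v ≢ a → override a t S v ≡ S v
  override-other {v} v≢a rewrite dec-false (v ≟ a) v≢a = refl

  override-closed : ∀ {f} → Involutive f → f a ≡ a → Closed f S → Closed f (override a t S)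
  override-closed {f} f-inv fa≡a S-closed v with v ≟ a
  ... | yes refl = trans (cong (override a t S) fa≡a) override-at
  ... | no v≢a   = trans (override-other fv≢a) (S-closed v)
    where
    fv≢a : f v ≢ a
    fv≢a e = v≢a (trans (≡-sym (f-inv v)) (trans (cong f e) fa≡a))

-- `a` is the new vertex of degree two with neighbours `u` and `b`, xy is the deleted edge, and `w`
-- is a common neighbour of `u`, `b`, `x`, `y`. The bundle makes the symmetries `flip-xy` and
-- `flip-ub` available as operations.
record Vertices (n : ℕ) : Set where
  field
    a u b x y w : Fin n
    u≢a : u ≢ a
    b≢a : b ≢ a
    b≢u : b ≢ u
    x≢a : x ≢ a
    x≢u : x ≢ u
    x≢b : x ≢ b
    y≢a : y ≢ a
    y≢u : y ≢ u
    y≢b : y ≢ b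
    x≢y : x ≢ y
    w≢a : w ≢ a
    w≢u : w ≢ u
    w≢b : w ≢ b
    w≢x : w ≢ x
    w≢y : w ≢ y

flip-xy : ∀ {n} → Vertices n → Vertices n
flip-xy V = record
  { a = a ; u = u ; b = b ; x = y ; y = x ; w = w
  ; u≢a = u≢a ; b≢a = b≢a ; b≢u = b≢u ; x≢a = y≢a ; x≢u = y≢u ; x≢b = y≢b
  ; y≢a = x≢a ; y≢u = x≢u ; y≢b = x≢b ; x≢y = ≢-sym x≢y
  ; w≢a = w≢a ; w≢u = w≢u ; w≢b = w≢b ; w≢x = w≢y ; w≢y = w≢x }
  where open Vertices V

flip-ub : ∀ {n} → Vertices n → Vertices n
flip-ub V = record
  { a = a ; u = b ; b = u ; x = x ; y = y ; w = w
  ; u≢a = b≢a ; b≢a = u≢a ; b≢u = ≢-sym b≢u ; x≢a = x≢a ; x≢u = x≢b ; x≢b = x≢u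
  ; y≢a = y≢a ; y≢u = y≢b ; y≢b = y≢u ; x≢y = x≢y
  ; w≢a = w≢a ; w≢u = w≢b ; w≢b = w≢u ; w≢x = w≢x ; w≢y = w≢y }
  where open Vertices V

module CommonNeighbour {k n : ℕ} (H : Graph n) (uncoverable : ∀ (M : Matchings k n) → ¬ Covers H M) where

  open Uncoverable H uncoverable

  record Config (V : Vertices n) (M : Matchings k n) : Set where
    open Vertices V
    field
      covers     : CoversBut H M u a
      c d p q s  : Fin k
      d≢c        : d ≢ c
      c-joins-ab : mate M c a ≡ b
      c-misses-u : Misses M c u
      a-misses   : ∀ {i} → i ≢ c → Misses M i a
      d-misses-x : Misses M d x
      d-misses-y : Misses M d y
      c-joins-wx : mate M c w ≡ x
      p-joins-wu : mate M p w ≡ u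
      q-joins-wb : mate M q w ≡ b
      s-joins-wy : mate M s w ≡ y

  module Facts (V : Vertices n) (M : Matchings k n) (C : Config V M) where

    open Vertices V public
    open Config C public

    distinct-colours : ∀ {i j v v′} → mate M i w ≡ v → mate M j w ≡ v′ → v ≢ v′ → i ≢ j
    distinct-colours iv jv v≢v′ refl = v≢v′ (trans (≡-sym iv) jv)

    p≢c : p ≢ c
    p≢c = distinct-colours p-joins-wu c-joins-wx (≢-sym x≢u)

    q≢c : q ≢ c
    q≢c = distinct-colours q-joins-wb c-joins-wx (≢-sym x≢b)

    s≢c : s ≢ c
    s≢c = distinct-colours s-joins-wy c-joins-wx (≢-sym x≢y)

    p≢s : p ≢ s
    p≢s = distinct-colours p-joins-wu s-joins-wy (≢-sym y≢u)

    s≢d : s ≢ d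
    s≢d refl = w≢y (trans (≡-sym (mate-flip M s-joins-wy)) d-misses-y)

    -- Otherwise the (c, d)-chain from `u`, which has to end at `a`, would run through `w` to `x`
    -- and stop there.
    p≢d : p ≢ d
    p≢d refl with linking-chain M u≢a covers c-misses-u (a-misses d≢c)
    ... | T , Tc , Td , u∈T , _ , ends = true≢false (trans (≡-sym x∈T) (ends x x≢u x≢a (inj₂ d-misses-x)))
      where
      x∈T : T x ≡ true
      x∈T = trans (cong T (≡-sym c-joins-wx)) (trans (Tc w)
              (trans (≡-sym (Td w)) (trans (cong T p-joins-wu) u∈T)))

    c-avoids-a : ∀ {v} → v ≢ b → mate M c v ≢ a
    c-avoids-a v≢b e = v≢b (trans (≡-sym (mate-flip M e)) c-joins-ab)

    -- The edge wu is recoloured c, its colour p moves to ua, and wx becomes uncovered.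
    private
      module S₁ = SlideColour M {p} {u} {a} u≢a (a-misses p≢c)

      c-misses-u₁ : Misses S₁.slideColour c u
      c-misses-u₁ = trans (S₁.slideColour-other (≢-sym p≢c) u) c-misses-u

      module S₂ = SlideColour S₁.slideColour {c} {w} {u} w≢u c-misses-u₁

    shifted : Matchings k n
    shifted = S₂.slideColour

    shifted-other : ∀ {i} → i ≢ p → i ≢ c → ∀ v → mate shifted i v ≡ mate M i v
    shifted-other i≢p i≢c v = trans (S₂.slideColour-other i≢c v) (S₁.slideColour-other i≢p v)

    shifted-p : ∀ v → mate shifted p v ≡ slide (mate M p) u a v
    shifted-p v = trans (S₂.slideColour-other p≢c v) (S₁.slideColour-at v)

    shifted-c : ∀ v → mate shifted c v ≡ slide (mate M c) w u v
    shifted-c v = trans (S₂.slideColour-at v) (slide-cong (S₁.slideColour-other (≢-sym p≢c)) w u v)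

    shifted-covers : CoversBut H shifted w x
    shifted-covers = subst (CoversBut H shifted w)
      (trans (S₁.slideColour-other (≢-sym p≢c) w) c-joins-wx)
      (S₂.slideColour-coversBut H (coversBut-sym H S₁.slideColour
        (subst (CoversBut H S₁.slideColour u) (mate-flip M p-joins-wu)
          (S₁.slideColour-coversBut H covers))))

    p-frees-w : slide (mate M p) u a w ≡ w
    p-frees-w = subst (λ v → slide (mate M p) u a v ≡ v) pu≡w
      (slide-freed (mate M p) u a (subst (_≢ u) (≡-sym pu≡w) w≢u) (subst (_≢ a) (≡-sym pu≡w) w≢a))
      where
      pu≡w : mate M p u ≡ w
      pu≡w = mate-flip M p-joins-wu

    c-frees-x : slide (mate M c) w u x ≡ x
    c-frees-x = subst (λ v → slide (mate M c) w u v ≡ v) c-joins-wx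
      (slide-freed (mate M c) w u (subst (_≢ w) (≡-sym c-joins-wx) (≢-sym w≢x))
        (subst (_≢ u) (≡-sym c-joins-wx) x≢u))

    -- Only the shifted matching `p` and the matching `d` enter. The colourings built below differ
    -- in other colours but share these two, so facts drawn from different colourings can be
    -- combined.
    LinkedToW : Fin n → Set
    LinkedToW z = ∀ T → Closed (slide (mate M p) u a) T → Closed (mate M d) T → T w ≡ T z

    x-linked : LinkedToW x
    x-linked T Tp Td = linked shifted {i = p} {j = d} w≢x shifted-covers
      (trans (shifted-p w) p-frees-w) (trans (shifted-other (≢-sym p≢d) d≢c x) d-misses-x)
      T (λ v → trans (cong T (shifted-p v)) (Tp v))
        (λ v → trans (cong T (shifted-other (≢-sym p≢d) d≢c v)) (Td v))

    -- By `x-linked` the (d, p)-chain from `x` already has `w` as its other end; `y`, which misses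
    -- `d`, would be a third.
    y-not-linked : ¬ LinkedToW y
    y-not-linked y-linked
      with chain (mate M d) (slide (mate M p) u a) (mate-involutive M d)
             (slide-involutive (mate M p) u a (mate-involutive M p) (a-misses p≢c) u≢a) x d-misses-x
    ... | T , Td , Tp , x∈T , unique =
      w≢y (unique w y w≢x (≢-sym x≢y) (inj₂ p-frees-w) (inj₁ d-misses-y) w∈T
            (trans (≡-sym (y-linked T Tp Td)) w∈T))
      where
      w∈T : T w ≡ true
      w∈T = trans (x-linked T Tp Td) x∈T

    -- S will be a (c, s)-chain from x, where the edges wx and ab of colour c have been deleted.
    AlmostClosed : (Fin n → Bool) → Set
    AlmostClosed S = Closed (mate M s) S ×
      (∀ {v} → v ≢ a → v ≢ b → v ≢ u → v ≢ w → v ≢ x → S (mate M c v) ≡ S v)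

    -- Swapping `c` and `s` on the chain in the shifted colouring makes `x` miss `s`, while `w`
    -- keeps `s` on wy. Then `s` moves from wy to wx, so that wy is the only uncovered edge and
    -- `linked` ties `w` to `y`.
    reaches-w-or-u : ∀ S → AlmostClosed S → S x ≡ true → S w ≡ false → S u ≡ false → ⊥
    reaches-w-or-u S (Ss , Sc) x∈S w∉S u∉S = y-not-linked y-linked
      where
      T : Fin n → Bool
      -- The colour `c` still joins `a` and `b` after the shift, so `a` is put on the side of `b`.
      T = override a (S b) S

      T-other : ∀ {v} → v ≢ a → T v ≡ S v
      T-other = override-other a (S b) S

      Ta : T a ≡ S b
      Ta = override-at a (S b) S

      T-slide : Closed (slide (mate M c) w u) T
      T-slide v = by-cases (v ≟ w) (v ≟ u) (v ≟ x) (v ≟ a) (v ≟ b)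
        where
        Tw≡Tu : T w ≡ T u
        Tw≡Tu = trans (trans (T-other w≢a) w∉S) (≡-sym (trans (T-other u≢a) u∉S))

        ≢cw : ∀ {z} → z ≢ x → z ≢ mate M c w
        ≢cw z≢x e = z≢x (trans e c-joins-wx)

        by-cases : Dec (v ≡ w) → Dec (v ≡ u) → Dec (v ≡ x) → Dec (v ≡ a) → Dec (v ≡ b) →
          T (slide (mate M c) w u v) ≡ T v
        by-cases (yes refl) _ _ _ _ = trans (cong T (slide-at (mate M c) w u)) (≡-sym Tw≡Tu)
        by-cases _ (yes refl) _ _ _ = trans (cong T (slide-target (mate M c) w u w≢u)) Tw≡Tu
        by-cases _ _ (yes refl) _ _ = cong T c-frees-x
        by-cases _ _ _ (yes refl) _ =
          trans (cong T (trans (slide-other (mate M c) w u (≢-sym w≢a) (≢-sym u≢a) (≢cw (≢-sym x≢a))) c-joins-ab))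
            (trans (T-other b≢a) (≡-sym Ta))
        by-cases _ _ _ _ (yes refl) =
          trans (cong T (trans (slide-other (mate M c) w u (≢-sym w≢b) b≢u (≢cw (≢-sym x≢b))) (mate-flip M c-joins-ab)))
            (trans Ta (≡-sym (T-other b≢a)))
        by-cases (no v≢w) (no v≢u) (no v≢x) (no v≢a) (no v≢b) =
          trans (cong T (slide-other (mate M c) w u v≢w v≢u (≢cw v≢x)))
            (trans (T-other (c-avoids-a v≢b)) (trans (Sc v≢a v≢b v≢u v≢w v≢x) (≡-sym (T-other v≢a))))

      Tc : Closed (mate shifted c) T
      Tc v = trans (cong T (shifted-c v)) (T-slide v)

      shifted-s : ∀ v → mate shifted s v ≡ mate M s v
      shifted-s = shifted-other (≢-sym p≢s) s≢c

      Ts : Closed (mate shifted s) T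
      Ts v = trans (cong T (shifted-s v))
        (override-closed a (S b) S (mate-involutive M s) (a-misses s≢c) Ss v)

      open Swap shifted c s T Tc Ts

      s-misses-x : Misses swap s x
      s-misses-x = trans (swap-on (trans (T-other x≢a) x∈S) s)
        (trans (cong (λ i → mate shifted i x) (transpose-at-r c s)) (trans (shifted-c x) c-frees-x))

      module S₃ = SlideColour swap {s} {w} {x} w≢x s-misses-x

      covers₃ : CoversBut H S₃.slideColour w y
      covers₃ = subst (CoversBut H S₃.slideColour w)
        (trans (swap-off (trans (T-other w≢a) w∉S) s) (trans (shifted-s w) s-joins-wy))
        (S₃.slideColour-coversBut H (swap-coversBut H shifted-covers))

      unswapped : ∀ {i} → i ≢ c → i ≢ s → ∀ v → mate S₃.slideColour i v ≡ mate shifted i v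
      unswapped i≢c i≢s v = trans (S₃.slideColour-other i≢s v) (swap-other i≢c i≢s v)

      p₃ : ∀ v → mate S₃.slideColour p v ≡ slide (mate M p) u a v
      p₃ v = trans (unswapped p≢c p≢s v) (shifted-p v)

      d₃ : ∀ v → mate S₃.slideColour d v ≡ mate M d v
      d₃ v = trans (unswapped d≢c (≢-sym s≢d) v) (shifted-other (≢-sym p≢d) d≢c v)

      y-linked : LinkedToW y
      y-linked R Rp Rd = linked S₃.slideColour {i = p} {j = d} w≢y covers₃
        (trans (p₃ w) p-frees-w) (trans (d₃ y) d-misses-y)
        R (λ v → trans (cong R (p₃ v)) (Rp v)) (λ v → trans (cong R (d₃ v)) (Rd v))

  module _ (V : Vertices n) (M : Matchings k n) (C : Config V M) where

    open Facts V M C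

    -- Moving `c` from ab to ua makes ab the uncovered edge and exchanges the roles of `u` and `b`,
    -- and with them those of `p` and `q`.
    reaches-w-or-b : ∀ S → AlmostClosed S → S x ≡ true → S w ≡ false → S b ≡ false → ⊥
    reaches-w-or-b S (Ss , Sc) x∈S w∉S b∉S =
      Facts.reaches-w-or-u (flip-ub V) slideColour C′ S (Ss′ , Sc′) x∈S w∉S b∉S
      where
      open SlideColour M {c} {a} {u} (≢-sym u≢a) c-misses-u

      slid : ∀ {v} → v ≢ a → v ≢ u → v ≢ b → mate slideColour c v ≡ mate M c v
      slid v≢a v≢u v≢b = trans (slideColour-at _)
        (slide-other (mate M c) a u v≢a v≢u (λ e → v≢b (trans e c-joins-ab)))

      c-misses-b : Misses slideColour c b
      c-misses-b = trans (slideColour-at b) (subst (λ v → slide (mate M c) a u v ≡ v) c-joins-ab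
        (slide-freed (mate M c) a u (subst (_≢ a) (≡-sym c-joins-ab) b≢a)
          (subst (_≢ u) (≡-sym c-joins-ab) b≢u)))

      C′ : Config (flip-ub V) slideColour
      C′ = record
        { covers = coversBut-sym H slideColour (subst (CoversBut H slideColour a) c-joins-ab
            (slideColour-coversBut H (coversBut-sym H M covers)))
        ; c = c ; d = d ; p = q ; q = p ; s = s
        ; d≢c = d≢c
        ; c-joins-ab = trans (slideColour-at a) (slide-at (mate M c) a u)
        ; c-misses-u = c-misses-b
        ; a-misses = λ i≢c → trans (slideColour-other i≢c a) (a-misses i≢c)
        ; d-misses-x = trans (slideColour-other d≢c x) d-misses-x
        ; d-misses-y = trans (slideColour-other d≢c y) d-misses-y
        ; c-joins-wx = trans (slid w≢a w≢u w≢b) c-joins-wx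
        ; p-joins-wu = trans (slideColour-other q≢c w) q-joins-wb
        ; q-joins-wb = trans (slideColour-other p≢c w) p-joins-wu
        ; s-joins-wy = trans (slideColour-other s≢c w) s-joins-wy }

      Ss′ : Closed (mate slideColour s) S
      Ss′ v = trans (cong S (slideColour-other s≢c v)) (Ss v)

      Sc′ : ∀ {v} → v ≢ a → v ≢ u → v ≢ b → v ≢ w → v ≢ x → S (mate slideColour c v) ≡ S v
      Sc′ v≢a v≢u v≢b v≢w v≢x = trans (cong S (slid v≢a v≢u v≢b)) (Sc v≢a v≢b v≢u v≢w v≢x)

    -- Here wx lies inside the chain and ab outside, so `c` and `s` can be swapped without a shift.
    -- This exchanges the colours of wx and wy, hence the roles of `x` and `y`, and `x-linked` for
    -- the new configuration ties `w` to `y`.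
    reaches-u-or-b : ∀ S → AlmostClosed S → S x ≡ true → S w ≡ true → S u ≡ false → S b ≡ false → ⊥
    reaches-u-or-b S (Ss , Sc) x∈S w∈S u∉S b∉S = y-not-linked y-linked
      where
      T : Fin n → Bool
      T = override a false S

      T-other : ∀ {v} → v ≢ a → T v ≡ S v
      T-other = override-other a false S

      Ta : T a ≡ false
      Ta = override-at a false S

      Tw : T w ≡ true
      Tw = trans (T-other w≢a) w∈S

      Tx : T x ≡ true
      Tx = trans (T-other x≢a) x∈S

      Tb : T b ≡ false
      Tb = trans (T-other b≢a) b∉S

      Tc : Closed (mate M c) T
      Tc v = by-cases (v ≟ w) (v ≟ u) (v ≟ x) (v ≟ a) (v ≟ b)
        where
        by-cases : Dec (v ≡ w) → Dec (v ≡ u) → Dec (v ≡ x) → Dec (v ≡ a) → Dec (v ≡ b) →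
          T (mate M c v) ≡ T v
        by-cases (yes refl) _ _ _ _ = trans (cong T c-joins-wx) (trans Tx (≡-sym Tw))
        by-cases _ (yes refl) _ _ _ = cong T c-misses-u
        by-cases _ _ (yes refl) _ _ = trans (cong T (mate-flip M c-joins-wx)) (trans Tw (≡-sym Tx))
        by-cases _ _ _ (yes refl) _ = trans (cong T c-joins-ab) (trans Tb (≡-sym Ta))
        by-cases _ _ _ _ (yes refl) = trans (cong T (mate-flip M c-joins-ab)) (trans Ta (≡-sym Tb))
        by-cases (no v≢w) (no v≢u) (no v≢x) (no v≢a) (no v≢b) =
          trans (T-other (c-avoids-a v≢b)) (trans (Sc v≢a v≢b v≢u v≢w v≢x) (≡-sym (T-other v≢a)))

      open Swap M c s T Tc (override-closed a false S (mate-involutive M s) (a-misses s≢c) Ss)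

      C′ : Config (flip-xy V) swap
      C′ = record
        { covers = swap-coversBut H covers
        ; c = c ; d = d ; p = p ; q = q ; s = s
        ; d≢c = d≢c
        ; c-joins-ab = trans (swap-off Ta c) c-joins-ab
        ; c-misses-u = trans (swap-off (trans (T-other u≢a) u∉S) c) c-misses-u
        ; a-misses = λ {i} i≢c → trans (swap-off Ta i) (a-misses i≢c)
        ; d-misses-x = trans (swap-other d≢c (≢-sym s≢d) y) d-misses-y
        ; d-misses-y = trans (swap-other d≢c (≢-sym s≢d) x) d-misses-x
        ; c-joins-wx = trans (swap-on Tw c) (trans (cong (λ i → mate M i w) (transpose-at-l c s)) s-joins-wy)
        ; p-joins-wu = trans (swap-other p≢c p≢s w) p-joins-wu
        ; q-joins-wb = trans (swap-other q≢c q≢s w) q-joins-wb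
        ; s-joins-wy = trans (swap-on Tw s) (trans (cong (λ i → mate M i w) (transpose-at-r c s)) c-joins-wx) }
        where
        q≢s : q ≢ s
        q≢s = distinct-colours q-joins-wb s-joins-wy (≢-sym y≢b)

      y-linked : LinkedToW y
      y-linked R Rp Rd = Facts.x-linked (flip-xy V) swap C′ R
        (λ v → trans (cong R (slide-cong (swap-other p≢c p≢s) u a v)) (Rp v))
        (λ v → trans (cong R (swap-other d≢c (≢-sym s≢d) v)) (Rd v))

    -- Once wx and ab are deleted from the matching `c`, each of `w`, `u`, `b` is an end vertex. The
    -- chain from `x` thus contains at most one of them, and each possibility is excluded by one of
    -- the preceding three lemmas.
    no-config : ⊥
    no-config = trace (chain c-cut (mate M s) c-cut-involutive (mate-involutive M s) x x-fixed)
      where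
      c-cut₁ : Fin n → Fin n
      c-cut₁ = cut (mate M c) x

      c-cut : Fin n → Fin n
      c-cut = cut c-cut₁ a

      c-cut-involutive : Involutive c-cut
      c-cut-involutive = cut-involutive c-cut₁ a (cut-involutive (mate M c) x (mate-involutive M c))

      cx≡w : mate M c x ≡ w
      cx≡w = mate-flip M c-joins-wx

      c-cut₁-a : c-cut₁ a ≡ b
      c-cut₁-a = trans (cut-other (mate M c) x (≢-sym x≢a) (λ e → w≢a (≡-sym (trans e cx≡w)))) c-joins-ab

      x-fixed : c-cut x ≡ x
      x-fixed = cut-fixed c-cut₁ a (cut-at (mate M c) x)

      w-fixed : c-cut w ≡ w
      w-fixed = cut-fixed c-cut₁ a (subst (λ v → c-cut₁ v ≡ v) cx≡w (cut-at-image (mate M c) x))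

      u-fixed : c-cut u ≡ u
      u-fixed = cut-fixed c-cut₁ a (cut-fixed (mate M c) x c-misses-u)

      b-fixed : c-cut b ≡ b
      b-fixed = subst (λ v → c-cut v ≡ v) c-cut₁-a (cut-at-image c-cut₁ a)

      trace : Chain c-cut (mate M s) x → ⊥
      trace (T , Tc , Ts , x∈T , unique) = by-ends (T w) (T u) (T b) refl refl refl
        where
        almost : AlmostClosed T
        almost = Ts , λ {v} v≢a v≢b v≢u v≢w v≢x →
          trans (cong T (≡-sym (trans (cut-other c-cut₁ a v≢a (λ e → v≢b (trans e c-cut₁-a)))
                                (cut-other (mate M c) x v≢x (λ e → v≢w (trans e cx≡w)))))) (Tc v)
        by-ends : ∀ tw tu tb → T w ≡ tw → T u ≡ tu → T b ≡ tb → ⊥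
        by-ends true  true  _     w∈ u∈ _  = w≢u (unique w u w≢x (≢-sym x≢u) (inj₁ w-fixed) (inj₁ u-fixed) w∈ u∈)
        by-ends true  _     true  w∈ _  b∈ = w≢b (unique w b w≢x (≢-sym x≢b) (inj₁ w-fixed) (inj₁ b-fixed) w∈ b∈)
        by-ends true  false false w∈ u∉ b∉ = reaches-u-or-b T almost x∈T w∈ u∉ b∉
        by-ends false false _     w∉ u∉ _  = reaches-w-or-u T almost x∈T w∉ u∉
        by-ends false true  false w∉ _  b∉ = reaches-w-or-b T almost x∈T w∉ b∉
        by-ends false true  true  _  u∈ b∈ =
          b≢u (unique b u (≢-sym x≢b) (≢-sym x≢u) (inj₁ b-fixed) (inj₁ u-fixed) b∈ u∈)

  -- The part of `Config` that concerns only `a`, `u` and `b`. Kempe changes off the chain from `u`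
  -- to `a` preserve it.
  record Precoloured (V : Vertices n) (c : Fin k) (M : Matchings k n) : Set where
    open Vertices V
    field
      covers     : CoversBut H M u a
      c-joins-ab : mate M c a ≡ b
      c-misses-u : Misses M c u
      a-misses   : ∀ {i} → i ≢ c → Misses M i a

  module _ (V : Vertices n) {c : Fin k} where

    open Vertices V
    open Precoloured

    recolour : ∀ {M} → Precoloured V c M → ∀ {j} → j ≢ c → ∃ λ M′ → Precoloured V c M′ ×
      (∀ {z} → z ≢ u → z ≢ a → EndVertex (mate M c) (mate M j) z →
         ∀ i → mate M′ i z ≡ mate M (transpose c j i) z)
    recolour {M} P j≢c with swap-away M u≢a (covers P) (c-misses-u P) (a-misses P j≢c)
    ... | M′ , cov′ , at-u , at-a , _ , ends = M′ , P′ , ends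
      where
      P′ : Precoloured V c M′
      P′ = record
        { covers = cov′ ; c-joins-ab = trans (at-a c) (c-joins-ab P)
        ; c-misses-u = trans (at-u c) (c-misses-u P)
        ; a-misses = λ {i} i≢c → trans (at-a i) (a-misses P i≢c) }

    module _ (wu : adj H w u ≡ true) (wb : adj H w b ≡ true)
             (wx : adj H w x ≡ true) (wy : adj H w y ≡ true) where

      colour-at-w : ∀ {M} → Precoloured V c M → ∀ {z} → adj H w z ≡ true → Covered M w z
      colour-at-w P {z} wz with covers P w z wz
      ... | inj₁ i                = i
      ... | inj₂ (inj₁ (w≡u , _)) = contradiction w≡u w≢u
      ... | inj₂ (inj₂ (w≡a , _)) = contradiction w≡a w≢a

      -- Let `r` be the colour of wx. A Kempe change of `c` and `r` off the chain from `u` to `a`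
      -- puts `c` on wx and makes `x` and `y` miss `r`, which then serves as the colour `d` of a
      -- `Config`.
      c-not-missing : ∀ {M} → Precoloured V c M → Misses M c x → Misses M c y → ⊥
      c-not-missing {M} P cx cy with colour-at-w P wx
      ... | r , rwx with recolour P r≢c
        where
        r≢c : r ≢ c
        r≢c refl = w≢x (≡-sym (trans (≡-sym cx) (mate-flip M rwx)))
      ... | M′ , P′ , ends with colour-at-w P′ wu | colour-at-w P′ wb | colour-at-w P′ wy
      ... | p , pwu | q , qwb | s , swy = no-config V M′ (record
        { covers = covers P′ ; c = c ; d = r ; p = p ; q = q ; s = s
        ; d≢c = λ { refl → w≢x (≡-sym (trans (≡-sym cx) (mate-flip M rwx))) }
        ; c-joins-ab = c-joins-ab P′ ; c-misses-u = c-misses-u P′ ; a-misses = a-misses P′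
        ; d-misses-x = now-missing x≢u x≢a cx ; d-misses-y = now-missing y≢u y≢a cy
        ; c-joins-wx = mate-flip M′ (trans (ends x≢u x≢a (inj₁ cx) c)
            (trans (cong (λ i → mate M i x) (transpose-at-l c r)) (mate-flip M rwx)))
        ; p-joins-wu = pwu ; q-joins-wb = qwb ; s-joins-wy = swy })
        where
        now-missing : ∀ {z} → z ≢ u → z ≢ a → Misses M c z → Misses M′ r z
        now-missing {z} z≢u z≢a cz = trans (ends z≢u z≢a (inj₁ cz) r)
          (trans (cong (λ i → mate M i z) (transpose-at-r c r)) cz)

      -- A Kempe change of `c` and `d` reduces this to the case in which `x` and `y` miss `c`.
      no-common-neighbour : ∀ {M d} → Precoloured V c M → Misses M d x → Misses M d y → ⊥
      no-common-neighbour {M} {d} P dx dy with d ≟ c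
      ... | yes refl = c-not-missing P dx dy
      ... | no d≢c with recolour P d≢c
      ...   | M′ , P′ , ends = c-not-missing P′ (now-missing x≢u x≢a dx) (now-missing y≢u y≢a dy)
        where
        now-missing : ∀ {z} → z ≢ u → z ≢ a → Misses M d z → Misses M′ c z
        now-missing {z} z≢u z≢a dz = trans (ends z≢u z≢a (inj₂ dz) c)
          (trans (cong (λ i → mate M i z) (transpose-at-l c d)) dz)

-- Counting neighbours

ι : Bool → ℕ
ι t = if t then 1 else 0

ι≤1 : ∀ t → ι t ≤ 1
ι≤1 true  = s≤s z≤n
ι≤1 false = z≤n

sum-tabulate : ∀ {n} (f : Fin n → ℕ) → List.sum (tabulate f) ≡ sum f
sum-tabulate {zero}  f = refl
sum-tabulate {suc n} f = cong (f zero +_) (sum-tabulate (f ∘ suc))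

deg≡sum : ∀ {n} (G : Graph n) v → deg G v ≡ ∑[ z < n ] ι (adj G v z)
deg≡sum {n} G v = trans (cong List.sum (map-tabulate id (λ u → ι (adj G v u)))) (sum-tabulate (λ z → ι (adj G v z)))

sum-const : ∀ n c → ∑[ _ < n ] c ≡ n * c
sum-const zero    c = refl
sum-const (suc n) c = cong (c +_) (sum-const n c)

sum-⁅⁆ : ∀ {n} (x : Fin n) c → ∑[ z < n ] (if ⁅ x ⁆ z then c else 0) ≡ c
sum-⁅⁆ {suc n} zero    c = trans (cong (c +_) (sum-replicate-zero n)) (+-identityʳ c)
sum-⁅⁆ {suc n} (suc x) c = sum-⁅⁆ x c

sum-≤-const : ∀ {n} (f : Fin n → ℕ) c → (∀ z → f z ≤ c) → sum f ≤ n * c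
sum-≤-const {n} f c f≤c = subst (sum f ≤_) (sum-const n c) (sum-mono-≤ f (λ _ → c) f≤c)

absorb : ∀ a {c} → a + c ≤ c → a ≡ 0
absorb a {c} le = n≤0⇒n≡0 (+-cancelʳ-≤ c a 0 le)

pair? : ∀ {n} (p q u v : Fin n) → Dec (Pair p q u v)
pair? p q u v = ((u ≟ p) ×-dec (v ≟ q)) ⊎-dec ((u ≟ q) ×-dec (v ≟ p))

pair-flip : ∀ {n} {p q u v : Fin n} → Pair p q u v → Pair p q v u
pair-flip (inj₁ (e , e′)) = inj₂ (e′ , e)
pair-flip (inj₂ (e , e′)) = inj₁ (e′ , e)

∧-not⁻ : ∀ {A : Set} t (a? : Dec A) → t ∧ not (does a?) ≡ true → t ≡ true × ¬ A
∧-not⁻ true (no ¬a) _ = refl , ¬a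

delete : ∀ {n} → Graph n → Fin n → Fin n → Graph n
delete G p q = record
  { adj = λ u v → adj G u v ∧ not (does (pair? p q u v))
  ; sym = λ u v → cong₂ _∧_ (sym G u v) (cong not (same u v))
  ; irrefl = λ v → cong (_∧ _) (irrefl G v) }
  where
  same : ∀ u v → does (pair? p q u v) ≡ does (pair? p q v u)
  same u v = does-⇔ (mk⇔ pair-flip pair-flip) (pair? p q u v) (pair? p q v u)

module _ {n} (G : Graph n) (p q : Fin n) where

  delete⁻ : ∀ {u v} → adj (delete G p q) u v ≡ true → adj G u v ≡ true × ¬ Pair p q u v
  delete⁻ {u} {v} = ∧-not⁻ (adj G u v) (pair? p q u v)

  delete⁺ : ∀ {u v} → adj G u v ≡ true → ¬ Pair p q u v → adj (delete G p q) u v ≡ true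
  delete⁺ {u} {v} uv ne rewrite uv | dec-false (pair? p q u v) ne = refl

  delete-covers : ∀ {k} (M : Matchings k n) → CoversBut G M p q → Covers (delete G p q) M
  delete-covers M cov u v uv with delete⁻ {u} {v} uv
  ... | e , ne with cov u v e
  ...   | inj₁ c = c
  ...   | inj₂ r = contradiction r ne

-- Here a and b stand for the two new vertices v₁ and v₂.
record IsSplit {n} (k : ℕ) (G : Graph n) (a b : Fin n) : Set where
  field
    ab-adjacent  : adj G a b ≡ true
    colouring    : Matchings k n
    covers       : CoversBut G colouring a b
    total        : Total colouring a b
    a-neighbour  : ∃ λ z → adj G a z ≡ true × z ≢ b
    b-neighbour  : ∃ λ z → adj G b z ≡ true × z ≢ a
    old-degree   : ∀ {z} → z ≢ a → z ≢ b → deg G z ≡ k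
    new-degrees  : deg G a + deg G b ≡ k + 2

isSplit-flip : ∀ {n k} {G : Graph n} {a b} → IsSplit k G a b → IsSplit k G b a
isSplit-flip {G = G} {a} {b} S = record
  { ab-adjacent = adj-flip G ab-adjacent ; colouring = colouring
  ; covers = coversBut-sym G colouring covers ; total = λ i → Sum.swap (total i)
  ; a-neighbour = b-neighbour ; b-neighbour = a-neighbour
  ; old-degree = λ z≢b z≢a → old-degree z≢a z≢b
  ; new-degrees = trans (+-comm (deg G b) (deg G a)) new-degrees }
  where open IsSplit S

-- Edges that avoid both new vertices

module FarEdge {n k} (G : Graph n) (x y : Fin n) (x≢y : x ≢ y)
  (uncoverable : ∀ (M : Matchings k n) → ¬ Covers (delete G x y) M) where

  private
    H : Graph n
    H = delete G x y

  open Adjacency H uncoverable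
  open CommonNeighbour H uncoverable

  -- M colours all edges of G except ab and xy, and α was the colour of xy.
  record Near (a b : Fin n) (M : Matchings k n) (α : Fin k) : Set where
    field
      split      : IsSplit k G a b
      x≢a        : x ≢ a
      x≢b        : x ≢ b
      y≢a        : y ≢ a
      y≢b        : y ≢ b
      covers     : CoversBut H M a b
      total      : Total M a b
      α-misses-x : Misses M α x
      α-misses-y : Misses M α y

  near-flip : ∀ {a b M α} → Near a b M α → Near b a M α
  near-flip {M = M} N = record
    { split = isSplit-flip split ; x≢a = x≢b ; x≢b = x≢a ; y≢a = y≢b ; y≢b = y≢a
    ; covers = coversBut-sym H M covers ; total = λ i → Sum.swap (total i)
    ; α-misses-x = α-misses-x ; α-misses-y = α-misses-y }
    where open Near N

  avoids-xy : ∀ {u v} → x ≢ u → y ≢ u → ¬ Pair x y u v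
  avoids-xy x≢u y≢u (inj₁ (u≡x , _)) = x≢u (≡-sym u≡x)
  avoids-xy x≢u y≢u (inj₂ (u≡y , _)) = y≢u (≡-sym u≡y)

  keep : ∀ {u v} → x ≢ u → y ≢ u → adj G u v ≡ true → adj H u v ≡ true
  keep x≢u y≢u uv = delete⁺ G x y uv (avoids-xy x≢u y≢u)

  keep′ : ∀ {u v} → x ≢ u → y ≢ u → adj G v u ≡ true → adj H v u ≡ true
  keep′ x≢u y≢u vu = delete⁺ G x y vu (avoids-xy x≢u y≢u ∘ pair-flip)

  TwoMissing : Matchings k n → Fin n → Set
  TwoMissing M v = ∃ λ i → ∃ λ j → i ≢ j × Misses M i v × Misses M j v

  module _ {a b : Fin n} {M : Matchings k n} {α : Fin k} (N : Near a b M α) where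

    open Near N
    open IsSplit split using (ab-adjacent; a-neighbour)

    a≢b : a ≢ b
    a≢b = adjacent⇒≢ G ab-adjacent

    colour-at-a : ∀ {z} → adj G a z ≡ true → z ≢ b → ∃ λ γ → mate M γ a ≡ z × Misses M γ b
    colour-at-a {z} az z≢b with covers a z (keep x≢a y≢a az)
    ... | inj₂ (inj₁ (_ , z≡b)) = contradiction z≡b z≢b
    ... | inj₂ (inj₂ (a≡b , _)) = contradiction a≡b a≢b
    ... | inj₁ (γ , γaz) with total γ
    ...   | inj₁ γa = contradiction (trans (≡-sym γa) γaz) (adjacent⇒≢ G az)
    ...   | inj₂ γb = γ , γaz , γb

    b-missing : ∃ λ γ → Misses M γ b
    b-missing with a-neighbour
    ... | z , az , z≢b with colour-at-a az z≢b
    ...   | γ , _ , γb = γ , γb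

    bx-nonadjacent : adj G b x ≢ true
    bx-nonadjacent bx = nonadjacent a≢b x≢a x≢b M covers total (proj₂ b-missing) α-misses-x (keep x≢b y≢b bx)

    by-nonadjacent : adj G b y ≢ true
    by-nonadjacent by = nonadjacent a≢b y≢a y≢b M covers total (proj₂ b-missing) α-misses-y (keep x≢b y≢b by)

  module _ {a b : Fin n} {M : Matchings k n} {α : Fin k} (N : Near a b M α) where

    open Near N

    -- A common neighbour `z` of `b` and `x` would complete a Kierstead path `a`, `b`, `z`, `x`.
    far-apart : TwoMissing M b → ∀ z → adj G b z ≡ true → adj G x z ≢ true
    far-apart (i , j , i≢j , ib , jb) z bz xz = no-kierstead-path (a≢b N) x≢a x≢b z≢a z≢b (adjacent⇒≢ G xz)
      {M} setting (delete⁺ G x y (adj-flip G xz) not-xy) α-misses-x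
      where
      z≢b : z ≢ b
      z≢b = ≢-sym (adjacent⇒≢ G bz)
      z≢a : z ≢ a
      z≢a refl = bx-nonadjacent (near-flip N) (adj-flip G xz)
      z≢y : z ≢ y
      z≢y refl = by-nonadjacent N bz
      not-xy : ¬ Pair x y z x
      not-xy (inj₁ (z≡x , _)) = adjacent⇒≢ G xz (≡-sym z≡x)
      not-xy (inj₂ (z≡y , _)) = z≢y z≡y
      setting : Setting (a≢b N) x≢a x≢b z≢a z≢b (adjacent⇒≢ G xz) M
      setting = record { covers = coversBut-sym H M covers ; total = total ; α₁≢α₂ = i≢j
        ; α₁-misses-b = ib ; α₂-misses-b = jb
        ; β-colours = proj₁ (proj₂ (colour-at-a (near-flip N) bz z≢a)) }

  module _ {m} (n≡1+m : n ≡ suc m) (dense : 3 * m ≤ 4 * k) (k≥1 : 1 ≤ k)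
           {a b : Fin n} {M : Matchings k n} {α : Fin k} (N : Near a b M α) where

    open Near N
    open IsSplit split using (a-neighbour; old-degree; new-degrees)

    -- The neighbourhood of `x` is disjoint from those of `a` and `b`. Counted with weight two, it
    -- yields (k + 2) + 2k ≤ 2n.
    not-both-two : TwoMissing M b → TwoMissing M a → ⊥
    not-both-two at-b at-a = contradiction (absorb k bound) (>⇒≢ k≥1)
      where
      A B X : Fin n → ℕ
      A z = ι (adj G a z)
      B z = ι (adj G b z)
      X z = ι (adj G x z)

      pointwise : ∀ z → (A z + B z) + (X z + X z) ≤ 2
      pointwise z with adj G x z in xz | adj G a z in az | adj G b z in bz
      ... | true  | true  | _     = contradiction xz (far-apart (near-flip N) at-a z az)
      ... | true  | false | true  = contradiction xz (far-apart N at-b z bz)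
      ... | true  | false | false = ≤-refl
      ... | false | p     | q     = +-mono-≤ (+-mono-≤ (ι≤1 p) (ι≤1 q)) z≤n

      total-degree : sum (λ z → (A z + B z) + (X z + X z)) ≡ (k + 2) + (k + k)
      total-degree = begin
        sum (λ z → (A z + B z) + (X z + X z)) ≡⟨ ∑-distrib-+ (λ z → A z + B z) (λ z → X z + X z) ⟩
        sum (λ z → A z + B z) + sum (λ z → X z + X z) ≡⟨ cong₂ _+_ (∑-distrib-+ A B) (∑-distrib-+ X X) ⟩
        (sum A + sum B) + (sum X + sum X)
          ≡⟨ cong₂ _+_ (cong₂ _+_ (deg≡sum G a) (deg≡sum G b)) (cong₂ _+_ (deg≡sum G x) (deg≡sum G x)) ⟨
        (deg G a + deg G b) + (deg G x + deg G x)
          ≡⟨ cong₂ _+_ new-degrees (cong₂ _+_ (old-degree x≢a x≢b) (old-degree x≢a x≢b)) ⟩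
        (k + 2) + (k + k) ∎
        where open ≡-Reasoning

      -- The count is tripled to make `dense` applicable: 9k + 6 ≤ 6n = 6m + 6 ≤ 8k + 6.
      bound : k + (2 * (4 * k) + 6) ≤ 2 * (4 * k) + 6
      bound = begin
        k + (2 * (4 * k) + 6)     ≡⟨ rearrange k ⟩
        3 * ((k + 2) + (k + k))   ≡⟨ cong (3 *_) total-degree ⟨
        3 * sum (λ z → (A z + B z) + (X z + X z)) ≤⟨ *-monoʳ-≤ 3 (sum-≤-const _ 2 pointwise) ⟩
        3 * (n * 2)               ≡⟨ cong (λ t → 3 * (t * 2)) n≡1+m ⟩
        3 * (suc m * 2)           ≡⟨ rearrange′ m ⟩
        2 * (3 * m) + 6           ≤⟨ +-monoˡ-≤ 6 (*-monoʳ-≤ 2 dense) ⟩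
        2 * (4 * k) + 6           ∎
        where
        open ≤-Reasoning
        rearrange : ∀ k → k + (2 * (4 * k) + 6) ≡ 3 * ((k + 2) + (k + k))
        rearrange = solve-∀
        rearrange′ : ∀ m → 3 * (suc m * 2) ≡ 2 * (3 * m) + 6
        rearrange′ = solve-∀

    -- Every edge at `a` other than ab has a colour missing at `b`, and there is only one, so `a`
    -- has no neighbours besides `b` and one vertex `u`. Moving that colour to ab makes au the
    -- uncovered edge, as `no-common-neighbour` requires.
    one-missing : (∀ {i j} → Misses M i b → Misses M j b → i ≡ j) → ⊥
    one-missing only = at-neighbour a-neighbour
      where
      at-neighbour : (∃ λ u → adj G a u ≡ true × u ≢ b) → ⊥
      at-neighbour (u , au , u≢b) with colour-at-a N au u≢b
      ... | γ , γau , γb = contradiction (absorb 2 bound) λ ()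
        where
        u≢a : u ≢ a
        u≢a = ≢-sym (adjacent⇒≢ G au)

        ax : adj G a x ≢ true
        ax = bx-nonadjacent (near-flip N)

        ay : adj G a y ≢ true
        ay = by-nonadjacent (near-flip N)

        x≢u : x ≢ u
        x≢u refl = ax au

        y≢u : y ≢ u
        y≢u refl = ay au

        a-neighbours : ∀ z → adj G a z ≡ true → z ≢ b → z ≡ u
        a-neighbours z az z≢b with colour-at-a N az z≢b
        ... | γ′ , γ′az , γ′b rewrite only γ′b γb = trans (≡-sym γ′az) γau

        open SlideColour M {γ} {a} {b} (a≢b N) γb

        covers₁ : CoversBut H slideColour a u
        covers₁ = subst (CoversBut H slideColour a) γau (slideColour-coversBut H covers)

        γ-misses-u : Misses slideColour γ u
        γ-misses-u = trans (slideColour-at u) (subst (λ v → slide (mate M γ) a b v ≡ v) γau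
          (slide-freed (mate M γ) a b (subst (_≢ a) (≡-sym γau) u≢a) (subst (_≢ b) (≡-sym γau) u≢b)))

        a-misses : ∀ {i} → i ≢ γ → Misses slideColour i a
        a-misses {i} i≢γ with total i
        ... | inj₁ ia = trans (slideColour-other i≢γ a) ia
        ... | inj₂ ib = contradiction (only ib γb) i≢γ

        total₁ : Total slideColour a u
        total₁ i = by-colour (i ≟ γ)
          where
          by-colour : Dec (i ≡ γ) → Misses slideColour i a ⊎ Misses slideColour i u
          by-colour (yes refl) = inj₂ γ-misses-u
          by-colour (no i≢γ)   = inj₁ (a-misses i≢γ)

        still-missing : ∀ {z} → z ≢ a → z ≢ b → Misses M α z → Misses slideColour α z
        still-missing {z} z≢a z≢b αz with α ≟ γ
        ... | no α≢γ   = αz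
        ... | yes refl = slide-fixed (mate M γ) a b z≢a z≢b αz

        αx₁ : Misses slideColour α x
        αx₁ = still-missing x≢a x≢b α-misses-x

        αy₁ : Misses slideColour α y
        αy₁ = still-missing y≢a y≢b α-misses-y

        ux : adj G u x ≢ true
        ux e = nonadjacent (≢-sym u≢a) x≢a x≢u slideColour {α} {γ} covers₁ total₁ γ-misses-u αx₁ (keep x≢u y≢u e)

        uy : adj G u y ≢ true
        uy e = nonadjacent (≢-sym u≢a) y≢a y≢u slideColour {α} {γ} covers₁ total₁ γ-misses-u αy₁ (keep x≢u y≢u e)

        no-common : ∀ w → adj G u w ≡ true → adj G b w ≡ true → adj G x w ≡ true → adj G y w ≢ true
        no-common w uw bw xw yw = no-common-neighbour V
          (keep′ x≢u y≢u (adj-flip G uw)) (keep′ x≢b y≢b (adj-flip G bw))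
          (delete⁺ G x y (adj-flip G xw) not-xy) (delete⁺ G x y (adj-flip G yw) not-xy)
          {M = slideColour} {d = α}
          (record { covers = coversBut-sym H slideColour covers₁
                  ; c-joins-ab = trans (slideColour-at a) (slide-at (mate M γ) a b)
                  ; c-misses-u = γ-misses-u ; a-misses = a-misses })
          αx₁ αy₁
          where
          w≢x : w ≢ x
          w≢x = ≢-sym (adjacent⇒≢ G xw)
          w≢y : w ≢ y
          w≢y = ≢-sym (adjacent⇒≢ G yw)
          not-xy : ∀ {v} → ¬ Pair x y w v
          not-xy = avoids-xy (≢-sym w≢x) (≢-sym w≢y)
          V : Vertices n
          V = record
            { a = a ; u = u ; b = b ; x = x ; y = y ; w = w
            ; u≢a = u≢a ; b≢a = ≢-sym (a≢b N) ; b≢u = ≢-sym u≢b ; x≢a = x≢a ; x≢u = x≢u ; x≢b = x≢b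
            ; y≢a = y≢a ; y≢u = y≢u ; y≢b = y≢b ; x≢y = x≢y
            ; w≢a = λ { refl → ax (adj-flip G xw) }
            ; w≢u = ≢-sym (adjacent⇒≢ G uw) ; w≢b = ≢-sym (adjacent⇒≢ G bw)
            ; w≢x = w≢x ; w≢y = w≢y }

        U B X Y at-a at-x at-y load : Fin n → ℕ
        U z = ι (adj G u z)
        B z = ι (adj G b z)
        X z = ι (adj G x z)
        Y z = ι (adj G y z)
        at-a z = if ⁅ a ⁆ z then 1 else 0
        at-x z = if ⁅ x ⁆ z then 2 else 0
        at-y z = if ⁅ y ⁆ z then 2 else 0
        -- By `no-common`, a vertex lies in at most three of the four neighbourhoods. The vertex `a`
        -- lies in at most two, since `x` and `y` are not adjacent to it; `x` lies at most in that
        -- of `y`, and `y` at most in that of `x`. The resulting slack 1 + 2 + 2 is decisive, as 4k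
        -- ≤ 3n alone is no contradiction.
        load z = ((U z + B z) + (X z + Y z)) + (at-a z + (at-x z + at-y z))

        pointwise : ∀ z → load z ≤ 3
        pointwise z with z ≟ a
        ... | yes refl
          rewrite ⁅⁆-≢ (≢-sym x≢a) | ⁅⁆-≢ (≢-sym y≢a)
                | sym G x a | ¬-not ax | sym G y a | ¬-not ay
          = +-mono-≤ (+-mono-≤ (+-mono-≤ (ι≤1 (adj G u a)) (ι≤1 (adj G b a))) (z≤n {0})) (≤-refl {1})
        ... | no z≢a with z ≟ x
        ...   | yes refl
          rewrite ⁅⁆-≢ x≢y | ¬-not ux | ¬-not (bx-nonadjacent N) | irrefl G x
          = +-mono-≤ (ι≤1 (adj G y x)) (≤-refl {2})
        ...   | no z≢x with z ≟ y
        ...     | yes refl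
          rewrite ¬-not uy | ¬-not (by-nonadjacent N) | irrefl G y
          = +-mono-≤ (+-mono-≤ (ι≤1 (adj G x y)) (z≤n {0})) (≤-refl {2})
        ...     | no z≢y with adj G u z in uz | adj G b z in bz | adj G x z in xz | adj G y z in yz
        ...       | true  | true  | true  | true  = contradiction yz (no-common z uz bz xz)
        ...       | true  | true  | true  | false = ≤-refl
        ...       | true  | true  | false | q = +-mono-≤ (+-mono-≤ (≤-refl {2}) (ι≤1 q)) (z≤n {0})
        ...       | true  | false | p     | q = +-mono-≤ (+-mono-≤ (≤-refl {1}) (+-mono-≤ (ι≤1 p) (ι≤1 q))) (z≤n {0})
        ...       | false | r     | p     | q =
          +-mono-≤ (+-mono-≤ (ι≤1 r) (+-mono-≤ (ι≤1 p) (ι≤1 q))) (z≤n {0})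

        deg-a≤2 : deg G a ≤ 2
        deg-a≤2 = begin
          deg G a                              ≡⟨ deg≡sum G a ⟩
          sum (λ z → ι (adj G a z))            ≤⟨ sum-mono-≤ _ _ only-two ⟩
          sum (λ z → at b z + at u z)          ≡⟨ ∑-distrib-+ (at b) (at u) ⟩
          sum (at b) + sum (at u)              ≡⟨ cong₂ _+_ (sum-⁅⁆ b 1) (sum-⁅⁆ u 1) ⟩
          2                                    ∎
          where
          open ≤-Reasoning
          at : Fin n → Fin n → ℕ
          at v z = if ⁅ v ⁆ z then 1 else 0
          only-two : ∀ z → ι (adj G a z) ≤ at b z + at u z
          only-two z with adj G a z in az | z ≟ b
          ... | false | _       = z≤n
          ... | true  | yes _   = s≤s z≤n
          ... | true  | no z≢b rewrite a-neighbours z az z≢b | ⁅⁆-refl u = ≤-refl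

        k≤deg-b : k ≤ deg G b
        k≤deg-b = +-cancelʳ-≤ 2 k (deg G b) (begin
          k + 2             ≡⟨ new-degrees ⟨
          deg G a + deg G b ≤⟨ +-monoˡ-≤ (deg G b) deg-a≤2 ⟩
          2 + deg G b       ≡⟨ +-comm 2 (deg G b) ⟩
          deg G b + 2       ∎)
          where open ≤-Reasoning

        total-load : sum load ≡ ((k + deg G b) + (k + k)) + 5
        total-load = begin
          sum load ≡⟨ ∑-distrib-+ (λ z → (U z + B z) + (X z + Y z)) (λ z → at-a z + (at-x z + at-y z)) ⟩
          sum (λ z → (U z + B z) + (X z + Y z)) + sum (λ z → at-a z + (at-x z + at-y z))
            ≡⟨ cong₂ _+_ (∑-distrib-+ (λ z → U z + B z) (λ z → X z + Y z))
                 (trans (∑-distrib-+ at-a (λ z → at-x z + at-y z))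
                        (cong₂ _+_ (sum-⁅⁆ a 1) (trans (∑-distrib-+ at-x at-y) (cong₂ _+_ (sum-⁅⁆ x 2) (sum-⁅⁆ y 2))))) ⟩
          (sum (λ z → U z + B z) + sum (λ z → X z + Y z)) + 5
            ≡⟨ cong (_+ 5) (cong₂ _+_ (∑-distrib-+ U B) (∑-distrib-+ X Y)) ⟩
          ((sum U + sum B) + (sum X + sum Y)) + 5
            ≡⟨ cong (_+ 5) (cong₂ _+_
                 (cong₂ _+_ (trans (≡-sym (deg≡sum G u)) (old-degree u≢a u≢b)) (≡-sym (deg≡sum G b)))
                 (cong₂ _+_ (trans (≡-sym (deg≡sum G x)) (old-degree x≢a x≢b))
                            (trans (≡-sym (deg≡sum G y)) (old-degree y≢a y≢b)))) ⟩
          ((k + deg G b) + (k + k)) + 5 ∎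
          where open ≡-Reasoning

        -- With k ≤ deg b the count reads 4k + 5 ≤ 3n = 3m + 3 ≤ 4k + 3.
        bound : 2 + (4 * k + 3) ≤ 4 * k + 3
        bound = begin
          2 + (4 * k + 3)               ≡⟨ rearrange k ⟩
          ((k + k) + (k + k)) + 5       ≤⟨ +-monoˡ-≤ 5 (+-monoˡ-≤ (k + k) (+-monoʳ-≤ k k≤deg-b)) ⟩
          ((k + deg G b) + (k + k)) + 5 ≡⟨ total-load ⟨
          sum load                      ≤⟨ sum-≤-const load 3 pointwise ⟩
          n * 3                         ≡⟨ cong (_* 3) n≡1+m ⟩
          suc m * 3                     ≡⟨ rearrange′ m ⟩
          3 * m + 3                     ≤⟨ +-monoˡ-≤ 3 dense ⟩
          4 * k + 3                     ∎
          where
          open ≤-Reasoning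
          rearrange : ∀ k → 2 + (4 * k + 3) ≡ ((k + k) + (k + k)) + 5
          rearrange = solve-∀
          rearrange′ : ∀ m → suc m * 3 ≡ 3 * m + 3
          rearrange′ = solve-∀

  one-or-two : ∀ (M : Matchings k n) b → (∀ {i j} → Misses M i b → Misses M j b → i ≡ j) ⊎ TwoMissing M b
  one-or-two M b with any? (λ i → any? (λ j → ¬? (i ≟ j) ×-dec (mate M i b ≟ b) ×-dec (mate M j b ≟ b)))
  ... | yes two = inj₂ two
  ... | no none = inj₁ λ {i} {j} ib jb → decidable-stable (i ≟ j) λ i≢j → none (i , j , i≢j , ib , jb)

  near-impossible : ∀ {m} → n ≡ suc m → 3 * m ≤ 4 * k → 1 ≤ k → ∀ {a b M α} → Near a b M α → ⊥
  near-impossible n≡ dense k≥1 {a} {b} {M} N with one-or-two M b | one-or-two M a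
  ... | inj₁ one | _        = one-missing n≡ dense k≥1 N one
  ... | inj₂ _   | inj₁ one = one-missing n≡ dense k≥1 (near-flip N) one
  ... | inj₂ two | inj₂ two′ = not-both-two n≡ dense k≥1 N two two′

-- Colourings and matchings

module FromColouring {n k} (G : Graph n) (c : Fin n → Fin n → Fin k) (proper : ProperEdgeColoring G k c) where

  private
    symmetric : ∀ u v → adj G u v ≡ true → c u v ≡ c v u
    symmetric = proj₁ proper

    partner? : ∀ i v → Dec (∃ λ u → adj G v u ≡ true × c v u ≡ i)
    partner? i v = any? (λ u → (adj G v u ≟ᵇ true) ×-dec (c v u ≟ i))

    partner : Fin k → Fin n → Fin n
    partner i v with partner? i v
    ... | yes (u , _) = u
    ... | no _        = v

    partner-≡ : ∀ {i u v} → adj G u v ≡ true → c u v ≡ i → partner i u ≡ v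
    partner-≡ {i} {u} {v} uv cuv with partner? i u
    ... | yes (w , uw , cuw) = proj₂ proper u w v uw uv (trans cuw (≡-sym cuv))
    ... | no none            = contradiction (v , uv , cuv) none

    partner-edge : ∀ i v → partner i v ≡ v ⊎ (adj G v (partner i v) ≡ true × c v (partner i v) ≡ i)
    partner-edge i v with partner? i v
    ... | yes (u , vu , cvu) = inj₂ (vu , cvu)
    ... | no _               = inj₁ refl

    partner-involutive : ∀ i → Involutive (partner i)
    partner-involutive i v with partner-edge i v
    ... | inj₁ e = trans (cong (partner i) e) e
    ... | inj₂ (vu , cvu) = partner-≡ (adj-flip G vu) (trans (≡-sym (symmetric v _ vu)) cvu)

  matchings : Matchings k n
  matchings = record { mate = partner ; mate-involutive = partner-involutive }

  matchings-cover : Covers G matchings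
  matchings-cover u v uv = c u v , partner-≡ uv refl

  matched : ∀ i v → Misses matchings i v ⊎
    (adj G v (mate matchings i v) ≡ true × c v (mate matchings i v) ≡ i)
  matched = partner-edge

-- The least index satisfying `P`, with the last index as default. The default serves the non-edges,
-- which need a colour too; hence the index type is nonempty.
first : ∀ {k} → (Fin (suc k) → Bool) → Fin (suc k)
first {zero}  P = zero
first {suc k} P = if P zero then zero else suc (first (P ∘ suc))

first-cong : ∀ {k} {P Q : Fin (suc k) → Bool} → (∀ i → P i ≡ Q i) → first P ≡ first Q
first-cong {zero}          P≗Q = refl
first-cong {suc k} {P} {Q} P≗Q rewrite P≗Q zero with Q zero
... | true  = refl
... | false = cong suc (first-cong (P≗Q ∘ suc))

first-satisfies : ∀ {k} (P : Fin (suc k) → Bool) i → P i ≡ true → P (first P) ≡ true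
first-satisfies {zero}  P zero    p = p
first-satisfies {suc k} P i       p with P zero in P0
first-satisfies {suc k} P i       p | true = P0
first-satisfies {suc k} P zero    p | false = contradiction (trans (≡-sym p) P0) true≢false
first-satisfies {suc k} P (suc i) p | false = first-satisfies (P ∘ suc) i p

-- An edge covered by several matchings takes the first of them, a choice independent of its
-- direction. Properness holds because a vertex has one mate per matching.
covered⇒colourable : ∀ {n k} (G : Graph n) (M : Matchings (suc k) n) → Covers G M → EdgeColorable G (suc k)
covered⇒colourable {n} {k} G M cov = colour , (λ u v _ → colour-sym u v) , proper
  where
  colour : Fin n → Fin n → Fin (suc k)
  colour u v = first (λ i → ⁅ v ⁆ (mate M i u))
  colour-sym : ∀ u v → colour u v ≡ colour v u
  colour-sym u v = first-cong λ i → does-⇔ (mk⇔ (mate-flip M) (mate-flip M)) (mate M i u ≟ v) (mate M i v ≟ u)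
  colour-spec : ∀ u v → adj G u v ≡ true → mate M (colour u v) u ≡ v
  colour-spec u v uv with cov u v uv
  ... | i , e = ⁅⁆⇒≡ v _ (first-satisfies (λ i → ⁅ v ⁆ (mate M i u)) i (dec-true (mate M i u ≟ v) e))
  proper : ∀ u v w → adj G u v ≡ true → adj G u w ≡ true → colour u v ≡ colour u w → v ≡ w
  proper u v w uv uw e = trans (≡-sym (colour-spec u v uv))
    (trans (cong (λ i → mate M i u) e) (colour-spec u w uw))

colourable-mono : ∀ {n j k} {G : Graph n} → j ≤ k → EdgeColorable G j → EdgeColorable G k
colourable-mono j≤k (c , c-sym , proper) =
  (λ u v → inject≤ (c u v) j≤k) , (λ u v uv → cong (λ i → inject≤ i j≤k) (c-sym u v uv)) ,
  λ u v w uv uw e → proper u v w uv uw (inject≤-injective j≤k j≤k _ _ e)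

-- The new colour starts as the empty matching, which every vertex misses, so sliding it onto pq
-- loses no edge.
extra-colour : ∀ {n k} {G : Graph n} {p q} (M : Matchings k n) → p ≢ q → CoversBut G M p q →
  ∃ λ (M′ : Matchings (suc k) n) → Covers G M′
extra-colour {n} {k} {G} {p} {q} M p≢q cov = M′ , covers
  where
  M⁺ : Matchings (suc k) n
  M⁺ = record { mate = λ { zero → id ; (suc i) → mate M i }
              ; mate-involutive = λ { zero _ → refl ; (suc i) → mate-involutive M i } }
  open SlideColour M⁺ {zero} {p} {q} p≢q refl
  M′ : Matchings (suc k) n
  M′ = slideColour
  covers : Covers G M′
  covers u v uv with slideColour-coversBut G (λ s t st → lift (cov s t st)) u v uv
    where
    lift : ∀ {s t} → Covered M s t ⊎ Pair p q s t → Covered M⁺ s t ⊎ Pair p q s t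
    lift (inj₁ (i , e)) = inj₁ (suc i , e)
    lift (inj₂ r)       = inj₂ r
  ... | inj₁ c = c
  ... | inj₂ (inj₁ (e , e′)) = contradiction (trans e (≡-sym e′)) (adjacent⇒≢ G uv)
  ... | inj₂ (inj₂ (e , e′)) = contradiction (trans e (≡-sym e′)) (adjacent⇒≢ G uv)

proper? : ∀ {n k} (G : Graph n) (c : Fin n → Fin n → Fin k) → Dec (ProperEdgeColoring G k c)
proper? G c =
  all? (λ u → all? λ v → (adj G u v ≟ᵇ true) →-dec (c u v ≟ c v u)) ×-dec
  all? (λ u → all? λ v → all? λ w →
    (adj G u v ≟ᵇ true) →-dec ((adj G u w ≟ᵇ true) →-dec ((c u v ≟ c u w) →-dec (v ≟ w))))

-- Exhaustive search over the codes in `Fin ((k ^ n) ^ n)`. Decidability admits the indirect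
-- argument for edges away from the new vertices and the search for the chromatic index of a
-- subgraph.
colourable? : ∀ {n} (G : Graph n) k → Dec (EdgeColorable G k)
colourable? {n} G k = map′ (λ (e , p) → decode e , p) encode (any? (proper? G ∘ decode))
  where
  decode : Fin ((k ^ n) ^ n) → Fin n → Fin n → Fin k
  decode e u = finToFun (finToFun e u)
  encode : EdgeColorable G k → ∃ λ e → ProperEdgeColoring G k (decode e)
  encode (c , c-sym , proper) = code ,
    (λ u v uv → trans (decoded u v) (trans (c-sym u v uv) (≡-sym (decoded v u)))) ,
    λ u v w uv uw e → proper u v w uv uw (trans (≡-sym (decoded u v)) (trans e (decoded u w)))
    where
    code : Fin ((k ^ n) ^ n)
    code = funToFin (funToFin ∘ c)
    decoded : ∀ u v → decode code u v ≡ c u v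
    decoded u v = trans (cong (λ e → finToFun e v) (finToFun-funToFin (funToFin ∘ c) u)) (finToFun-funToFin (c u) v)

chromatic-index : ∀ {n} (G : Graph n) k → EdgeColorable G k → ∃ λ j → ChromaticIndex G j × j ≤ k
chromatic-index G zero    colouring = zero , (colouring , λ _ _ → z≤n) , z≤n
chromatic-index G (suc k) colouring with colourable? G k
... | no ¬k = suc k , (colouring , λ j j-colourable → ≰⇒> λ j≤k → ¬k (colourable-mono {G = G} j≤k j-colourable)) , ≤-refl
... | yes k-colourable with chromatic-index G k k-colourable
...   | j , index , j≤k = j , index , m≤n⇒m≤1+n j≤k

-- Degrees and parity

term≤sum : ∀ {n} (f : Fin n → ℕ) i → f i ≤ sum f
term≤sum f zero    = m≤m+n _ _
term≤sum f (suc i) = ≤-trans (term≤sum (f ∘ suc) i) (m≤n+m _ (f zero))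

-- Every neighbour is the mate of `v` in some matching. After exchanging the two sums, each matching
-- contributes at most one neighbour.
deg≤colours : ∀ {n k} (G : Graph n) (M : Matchings k n) → Covers G M →
  ∀ v → deg G v ≤ ∑[ i < k ] moves (mate M i) v
deg≤colours {n} {k} G M cov v = begin
  deg G v                            ≡⟨ deg≡sum G v ⟩
  ∑[ u < n ] ι (adj G v u)           ≤⟨ sum-mono-≤ _ _ covered-by ⟩
  ∑[ u < n ] ∑[ i < k ] weight i u   ≡⟨ ∑-comm (λ u i → weight i u) ⟩
  ∑[ i < k ] ∑[ u < n ] weight i u   ≡⟨ sum-cong-≗ (λ i → sum-⁅⁆ (mate M i v) (moves (mate M i) v)) ⟩
  ∑[ i < k ] moves (mate M i) v      ∎
  where
  open ≤-Reasoning
  weight : Fin k → Fin n → ℕ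
  weight i u = if ⁅ mate M i v ⁆ u then moves (mate M i) v else 0
  covered-by : ∀ u → ι (adj G v u) ≤ ∑[ i < k ] weight i u
  covered-by u with adj G v u in vu
  ... | false = z≤n
  ... | true with cov v u vu
  ...   | i , refl = ≤-trans (≤-reflexive (≡-sym weight≡1)) (term≤sum (λ j → weight j u) i)
    where
    weight≡1 : weight i u ≡ 1
    weight≡1 rewrite ⁅⁆-refl u | dec-false (u ≟ v) (≢-sym (adjacent⇒≢ G vu)) = refl

moves≤1 : ∀ {n} (f : Fin n → Fin n) v → moves f v ≤ 1
moves≤1 f v with does (f v ≟ v)
... | true  = z≤n
... | false = ≤-refl

moves-fixed : ∀ {n} (f : Fin n → Fin n) {v} → f v ≡ v → moves f v ≡ 0
moves-fixed f {v} e rewrite dec-true (f v ≟ v) e = refl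

full-degree⇒¬misses : ∀ {n k} (G : Graph n) (M : Matchings k n) → Covers G M →
  ∀ {v} → deg G v ≡ k → ∀ i → ¬ Misses M i v
full-degree⇒¬misses {k = k} G M cov {v} full i i-misses = <-irrefl refl (begin-strict
  k                             ≡⟨ full ⟨
  deg G v                       ≤⟨ deg≤colours G M cov v ⟩
  ∑[ j < k ] moves (mate M j) v <⟨ sum-mono-< _ (λ _ → 1) (λ j → moves≤1 (mate M j) v) i
                                     (subst (_< 1) (≡-sym (moves-fixed (mate M i) i-misses)) ≤-refl) ⟩
  ∑[ j < k ] 1                  ≡⟨ trans (sum-const k 1) (*-identityʳ k) ⟩
  k                             ∎)
  where open ≤-Reasoning

-- v ↦ f v matches the points moved up with the points moved down.
fixed-point-free⇒even : ∀ {n} (f : Fin n → Fin n) → Involutive f → (∀ v → f v ≢ v) → ∃ λ h → n ≡ h + h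
fixed-point-free⇒even {n} f f-inv moved = sum up , (begin
  n                         ≡⟨ trans (sum-const n 1) (*-identityʳ n) ⟨
  ∑[ v < n ] 1              ≡⟨ sum-cong-≗ up-or-down ⟩
  ∑[ v < n ] (up v + down v) ≡⟨ ∑-distrib-+ up down ⟩
  sum up + sum down         ≡⟨ cong (sum up +_) (sum-permute down π) ⟩
  sum up + sum (down ∘ f)   ≡⟨ cong (sum up +_) (sum-cong-≗ λ v → cong (λ w → ι (does (w <? f v))) (f-inv v)) ⟩
  sum up + sum up           ∎)
  where
  open ≡-Reasoning
  up down : Fin n → ℕ
  up v   = ι (does (v <? f v))
  down v = ι (does (f v <? v))
  π : Permutation′ n
  π = permutation f f f-inv f-inv
  up-or-down : ∀ v → 1 ≡ up v + down v
  up-or-down v with <-cmp v (f v)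
  ... | tri< v<fv _ fv≮v rewrite dec-true (v <? f v) v<fv | dec-false (f v <? v) fv≮v = refl
  ... | tri≈ _ v≡fv _ = contradiction (≡-sym v≡fv) (moved v)
  ... | tri> v≮fv _ fv<v rewrite dec-false (v <? f v) v≮fv | dec-true (f v <? v) fv<v = refl

even⇒suc-odd : ∀ h h′ → suc (h + h) ≢ h′ + h′
even⇒suc-odd zero    (suc h′) e = contradiction (trans (suc-injective e) (+-suc h′ h′)) λ ()
even⇒suc-odd (suc h) (suc h′) e = even⇒suc-odd h h′ (suc-injective (suc-injective
  (trans (cong (λ t → suc (suc t)) (≡-sym (+-suc h h))) (trans e (cong suc (+-suc h′ h′))))))

max-≤ : ∀ {n} (f : Fin n → ℕ) {k} → (∀ v → f v ≤ k) → foldr _⊔_ 0 (tabulate f) ≤ k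
max-≤ {zero}  f f≤k = z≤n
max-≤ {suc n} f f≤k = ⊔-lub (f≤k zero) (max-≤ (f ∘ suc) (f≤k ∘ suc))

≤-max : ∀ {n} (f : Fin n → ℕ) v → f v ≤ foldr _⊔_ 0 (tabulate f)
≤-max f zero    = m≤m⊔n _ _
≤-max f (suc v) = ≤-trans (≤-max (f ∘ suc) v) (m≤n⊔m (f zero) _)

maxDeg≡ : ∀ {n} (G : Graph n) {k} → (∀ v → deg G v ≤ k) → ∀ v → deg G v ≡ k → maxDeg G ≡ k
maxDeg≡ G deg≤k v refl = trans (cong (foldr _⊔_ 0) (map-tabulate id (deg G)))
  (≤-antisym (max-≤ (deg G) deg≤k) (≤-max (deg G) v))

two-neighbours : ∀ {n} (G : Graph n) {v s t} → adj G v s ≡ true → adj G v t ≡ true → s ≢ t → 2 ≤ deg G v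
two-neighbours {n} G {v} {s} {t} vs vt s≢t = begin
  2                       ≡⟨ cong₂ _+_ (sum-⁅⁆ s 1) (sum-⁅⁆ t 1) ⟨
  sum (at s) + sum (at t) ≡⟨ ∑-distrib-+ (at s) (at t) ⟨
  ∑[ z < n ] (at s z + at t z) ≤⟨ sum-mono-≤ _ _ pointwise ⟩
  ∑[ z < n ] ι (adj G v z) ≡⟨ deg≡sum G v ⟨
  deg G v                 ∎
  where
  open ≤-Reasoning
  at : Fin n → Fin n → ℕ
  at w z = if ⁅ w ⁆ z then 1 else 0
  pointwise : ∀ z → at s z + at t z ≤ ι (adj G v z)
  pointwise z with z ≟ s
  ... | yes refl rewrite ⁅⁆-≢ s≢t | vs = ≤-refl
  ... | no _ with z ≟ t
  ...   | yes refl rewrite vt = ≤-refl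
  ...   | no _ = z≤n

-- The split graph

old-inject₁ : ∀ {m} (x : Fin m) → old (inject₁ x) ≡ just x
old-inject₁ zero    = refl
old-inject₁ (suc x) rewrite old-inject₁ x = refl

old-fromℕ : ∀ m → old (fromℕ m) ≡ nothing
old-fromℕ zero    = refl
old-fromℕ (suc m) rewrite old-fromℕ m = refl

vertex : ∀ {m} → Maybe (Fin m) → Fin (suc m)
vertex (just x)    = inject₁ x
vertex {m} nothing = fromℕ m

vertex-old : ∀ {m} (x : Fin (suc m)) → vertex (old x) ≡ x
vertex-old {zero}  zero    = refl
vertex-old {suc m} zero    = refl
vertex-old {suc m} (suc x) with old x in e
... | just y  = cong suc (trans (cong vertex (≡-sym e)) (vertex-old x))
... | nothing = cong suc (trans (cong vertex (≡-sym e)) (vertex-old x))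

∧-true⁻ : ∀ s t → s ∧ t ≡ true → s ≡ true × t ≡ true
∧-true⁻ true true _ = refl , refl

ι-split : ∀ s t → ι (s ∧ t) + ι (s ∧ not t) ≡ ι s
ι-split true  true  = refl
ι-split true  false = refl
ι-split false t     = refl

module Splitting {m} (G₀ : Graph m) (v : Fin m) (side : Fin m → Bool) where

  -- splitAdj on the labels of the vertices: just v is v₁ and nothing is v₂.
  labelAdj : Maybe (Fin m) → Maybe (Fin m) → Bool
  labelAdj (just a) (just b) with a ≟ v | b ≟ v
  ... | yes _ | yes _ = false
  ... | yes _ | no  _ = adj G₀ v b ∧ side b
  ... | no  _ | yes _ = adj G₀ v a ∧ side a
  ... | no  _ | no  _ = adj G₀ a b
  labelAdj (just a) nothing with a ≟ v
  ... | yes _ = true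
  ... | no  _ = adj G₀ v a ∧ not (side a)
  labelAdj nothing (just b) with b ≟ v
  ... | yes _ = true
  ... | no  _ = adj G₀ v b ∧ not (side b)
  labelAdj nothing nothing = false

  splitAdj≡labelAdj : ∀ x y → splitAdj G₀ v side x y ≡ labelAdj (old x) (old y)
  splitAdj≡labelAdj x y with old x | old y
  splitAdj≡labelAdj x y | just a | just b with a ≟ v | b ≟ v
  ... | yes _ | yes _ = refl
  ... | yes _ | no  _ = refl
  ... | no  _ | yes _ = refl
  ... | no  _ | no  _ = refl
  splitAdj≡labelAdj x y | just a | nothing with a ≟ v
  ... | yes _ = refl
  ... | no  _ = refl
  splitAdj≡labelAdj x y | nothing | just b with b ≟ v
  ... | yes _ = refl
  ... | no  _ = refl
  splitAdj≡labelAdj x y | nothing | nothing = refl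

  project : Maybe (Fin m) → Fin m
  project (just a) = a
  project nothing  = v

  -- The end on a's side of the edge that the edge ab of G₀ becomes.
  lift : Fin m → Fin m → Maybe (Fin m)
  lift a b with a ≟ v
  ... | no _  = just a
  ... | yes _ = if side b then just v else nothing

  NewEdge : Maybe (Fin m) → Maybe (Fin m) → Set
  NewEdge s t = (s ≡ just v × t ≡ nothing) ⊎ (s ≡ nothing × t ≡ just v)

  -- Apart from the new edge, an edge of the split graph can be recovered from its projection, since
  -- `side` of the other end tells which copy of `v` it is attached to.
  label-edge : ∀ s t → labelAdj s t ≡ true → ¬ NewEdge s t →
    adj G₀ (project s) (project t) ≡ true × s ≡ lift (project s) (project t)
  label-edge (just a) (just b) e new with a ≟ v | b ≟ v
  ... | yes refl | no _ with ∧-true⁻ (adj G₀ a b) (side b) e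
  ...   | ab , sb rewrite sb = ab , refl
  label-edge (just a) (just b) e new | no _ | yes refl = adj-flip G₀ (proj₁ (∧-true⁻ (adj G₀ b a) (side a) e)) , refl
  label-edge (just a) (just b) e new | no _ | no _ = e , refl
  label-edge (just a) nothing e new with a ≟ v
  ... | yes refl = contradiction (inj₁ (refl , refl)) new
  ... | no _ = adj-flip G₀ (proj₁ (∧-true⁻ (adj G₀ v a) (not (side a)) e)) , refl
  label-edge nothing (just b) e new with b ≟ v
  ... | yes refl = contradiction (inj₂ (refl , refl)) new
  ... | no _ with v ≟ v
  ...   | no v≢v = contradiction refl v≢v
  ...   | yes _ with ∧-true⁻ (adj G₀ v b) (not (side b)) e
  ...     | vb , nsb with side b
  ...       | false = vb , refl

  labelDegree : Maybe (Fin m) → ℕ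
  labelDegree s = ∑[ b < m ] ι (labelAdj s (just b)) + ι (labelAdj s nothing)

  old-labelDegree : ∀ {a} → a ≢ v → labelDegree (just a) ≡ deg G₀ a
  old-labelDegree {a} a≢v = begin
    labelDegree (just a)                       ≡⟨ cong (sum near +_) last ⟩
    -- The term for v₂ is booked at `b` = `v`, where it complements the term for v₁: an edge from
    -- `a` to `v` goes to exactly one of the two copies.
    sum near + extra                           ≡⟨ cong (sum near +_) (sum-⁅⁆ v extra) ⟨
    sum near + ∑[ b < m ] (if ⁅ v ⁆ b then extra else 0) ≡⟨ ∑-distrib-+ near (λ b → if ⁅ v ⁆ b then extra else 0) ⟨
    ∑[ b < m ] (near b + (if ⁅ v ⁆ b then extra else 0)) ≡⟨ sum-cong-≗ pointwise ⟩
    ∑[ b < m ] ι (adj G₀ a b)                  ≡⟨ deg≡sum G₀ a ⟨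
    deg G₀ a                                   ∎
    where
    open ≡-Reasoning
    near : Fin m → ℕ
    near b = ι (labelAdj (just a) (just b))
    extra : ℕ
    extra = ι (adj G₀ v a ∧ not (side a))
    last : ι (labelAdj (just a) nothing) ≡ extra
    last with a ≟ v
    ... | yes a≡v = contradiction a≡v a≢v
    ... | no _    = refl
    pointwise : ∀ b → near b + (if ⁅ v ⁆ b then extra else 0) ≡ ι (adj G₀ a b)
    pointwise b with a ≟ v | b ≟ v
    ... | yes a≡v | _        = contradiction a≡v a≢v
    ... | no _    | yes refl = trans (ι-split (adj G₀ v a) (side a)) (cong ι (sym G₀ v a))
    ... | no _    | no _     = +-identityʳ _

  labelDegree-v₁ : labelDegree (just v) ≡ ∑[ b < m ] ι (adj G₀ v b ∧ side b) + 1
  labelDegree-v₁ = cong₂ _+_ (sum-cong-≗ pointwise) last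
    where
    last : ι (labelAdj (just v) nothing) ≡ 1
    last with v ≟ v
    ... | yes _  = refl
    ... | no v≢v = contradiction refl v≢v
    pointwise : ∀ b → ι (labelAdj (just v) (just b)) ≡ ι (adj G₀ v b ∧ side b)
    pointwise b with v ≟ v | b ≟ v
    ... | no v≢v | _        = contradiction refl v≢v
    ... | yes _  | yes refl rewrite irrefl G₀ v = refl
    ... | yes _  | no _     = refl

  labelDegree-v₂ : labelDegree nothing ≡ ∑[ b < m ] ι (adj G₀ v b ∧ not (side b)) + 1
  labelDegree-v₂ = begin
    ∑[ b < m ] ι (labelAdj nothing (just b)) + 0    ≡⟨ +-identityʳ _ ⟩
    ∑[ b < m ] ι (labelAdj nothing (just b))        ≡⟨ sum-cong-≗ pointwise ⟩
    ∑[ b < m ] (ι (adj G₀ v b ∧ not (side b)) + at b) ≡⟨ ∑-distrib-+ (λ b → ι (adj G₀ v b ∧ not (side b))) at ⟩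
    ∑[ b < m ] ι (adj G₀ v b ∧ not (side b)) + sum at ≡⟨ cong (sum far +_) (sum-⁅⁆ v 1) ⟩
    ∑[ b < m ] ι (adj G₀ v b ∧ not (side b)) + 1    ∎
    where
    open ≡-Reasoning
    at far : Fin m → ℕ
    at b = if ⁅ v ⁆ b then 1 else 0
    far b = ι (adj G₀ v b ∧ not (side b))
    pointwise : ∀ b → ι (labelAdj nothing (just b)) ≡ ι (adj G₀ v b ∧ not (side b)) + at b
    pointwise b with b ≟ v
    ... | yes refl rewrite irrefl G₀ v = refl
    ... | no _     = ≡-sym (+-identityʳ _)

  new-labelDegrees : labelDegree (just v) + labelDegree nothing ≡ deg G₀ v + 2
  new-labelDegrees = begin
    labelDegree (just v) + labelDegree nothing ≡⟨ cong₂ _+_ labelDegree-v₁ labelDegree-v₂ ⟩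
    (sum f + 1) + (sum g + 1)  ≡⟨ rearrange (sum f) (sum g) ⟩
    (sum f + sum g) + 2        ≡⟨ cong (_+ 2) (∑-distrib-+ f g) ⟨
    ∑[ b < m ] (f b + g b) + 2 ≡⟨ cong (_+ 2) (sum-cong-≗ λ b → ι-split (adj G₀ v b) (side b)) ⟩
    ∑[ b < m ] ι (adj G₀ v b) + 2 ≡⟨ cong (_+ 2) (deg≡sum G₀ v) ⟨
    deg G₀ v + 2               ∎
    where
    open ≡-Reasoning
    f g : Fin m → ℕ
    f b = ι (adj G₀ v b ∧ side b)
    g b = ι (adj G₀ v b ∧ not (side b))
    rearrange : ∀ s t → (s + 1) + (t + 1) ≡ (s + t) + 2
    rearrange = solve-∀

  module _ (G : Graph (suc m)) (π : Permutation′ (suc m))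
           (iso : ∀ x y → adj G (π ⟨$⟩ʳ x) (π ⟨$⟩ʳ y) ≡ splitAdj G₀ v side x y) where

    place : Maybe (Fin m) → Fin (suc m)
    place s = π ⟨$⟩ʳ vertex s

    label : Fin (suc m) → Maybe (Fin m)
    label z = old (π ⟨$⟩ˡ z)

    label-place : ∀ s → label (place s) ≡ s
    label-place s = trans (cong old (inverseˡ π)) (old-vertex s)
      where
      old-vertex : ∀ s → old (vertex s) ≡ s
      old-vertex (just x) = old-inject₁ x
      old-vertex nothing  = old-fromℕ m

    place-label : ∀ z → place (label z) ≡ z
    place-label z = trans (cong (π ⟨$⟩ʳ_) (vertex-old (π ⟨$⟩ˡ z))) (inverseʳ π)

    adj-label : ∀ z w → adj G z w ≡ labelAdj (label z) (label w)
    adj-label z w = trans (cong₂ (adj G) (≡-sym (inverseʳ π)) (≡-sym (inverseʳ π)))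
      (trans (iso _ _) (splitAdj≡labelAdj _ _))

    adj-place : ∀ s t → adj G (place s) (place t) ≡ labelAdj s t
    adj-place s t = trans (adj-label _ _) (cong₂ labelAdj (label-place s) (label-place t))

    deg-label : ∀ z → deg G z ≡ labelDegree (label z)
    deg-label z = begin
      deg G z                                      ≡⟨ deg≡sum G z ⟩
      ∑[ w < suc m ] ι (adj G z w)                 ≡⟨ sum-permute (λ w → ι (adj G z w)) π ⟩
      ∑[ x < suc m ] ι (adj G z (π ⟨$⟩ʳ x))        ≡⟨ sum-init-last (λ x → ι (adj G z (π ⟨$⟩ʳ x))) ⟩
      ∑[ b < m ] ι (adj G z (place (just b))) + ι (adj G z (place nothing))
        ≡⟨ cong₂ _+_ (sum-cong-≗ λ b → cong ι (to-label (just b))) (cong ι (to-label nothing)) ⟩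
      labelDegree (label z)                        ∎
      where
      open ≡-Reasoning
      to-label : ∀ s → adj G z (place s) ≡ labelAdj (label z) s
      to-label s = trans (adj-label z (place s)) (cong (labelAdj (label z)) (label-place s))

    v₁ v₂ : Fin (suc m)
    v₁ = place (just v)
    v₂ = place nothing

    not-new : ∀ {z w} → ¬ Pair v₁ v₂ z w → ¬ NewEdge (label z) (label w)
    not-new {z} {w} ne (inj₁ (e , e′)) = ne (inj₁
      (trans (≡-sym (place-label z)) (cong place e) , trans (≡-sym (place-label w)) (cong place e′)))
    not-new {z} {w} ne (inj₂ (e , e′)) = ne (inj₂
      (trans (≡-sym (place-label z)) (cong place e) , trans (≡-sym (place-label w)) (cong place e′)))

    private
      G⁻ : Graph (suc m)
      G⁻ = delete G v₁ v₂

      ψ : Fin (suc m) → Fin m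
      ψ z = project (label z)

    module _ {z w} (zw : adj G⁻ z w ≡ true) where

      private
        edge : adj G₀ (ψ z) (ψ w) ≡ true × label z ≡ lift (ψ z) (ψ w)
        edge with delete⁻ G v₁ v₂ {z} {w} zw
        ... | e , ne = label-edge (label z) (label w) (trans (≡-sym (adj-label z w)) e) (not-new ne)

      project-edge : adj G₀ (ψ z) (ψ w) ≡ true
      project-edge = proj₁ edge

      tail-determined : z ≡ place (lift (ψ z) (ψ w))
      tail-determined = trans (≡-sym (place-label z)) (cong place (proj₂ edge))

    -- `lift` recovers the tail of an edge from its projection. This makes the colouring pulled back
    -- along `ψ` proper.
    edges-injective : ∀ {z w z′ w′} → adj G⁻ z w ≡ true → adj G⁻ z′ w′ ≡ true →
      ψ z ≡ ψ z′ → ψ w ≡ ψ w′ → z ≡ z′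
    edges-injective zw zw′ e e′ = trans (tail-determined zw)
      (trans (cong place (cong₂ lift e e′)) (≡-sym (tail-determined zw′)))

    isSplit : ∀ {k} → Regular G₀ k → EdgeColorable G₀ k →
      (∃ λ u → adj G₀ v u ∧ side u ≡ true) → (∃ λ u → adj G₀ v u ∧ not (side u) ≡ true) → IsSplit k G v₁ v₂
    isSplit {k} regular (c , c-sym , c-proper) (u₁ , vu₁) (u₂ , vu₂) = record
      { ab-adjacent = trans (adj-place (just v) nothing) v₁v₂
      ; colouring = matchings
      ; covers = covers
      ; total = total
      ; a-neighbour = place (just u₁) , trans (adj-place (just v) (just u₁)) v₁u₁ ,
          λ e → contradiction (trans (≡-sym (label-place (just u₁))) (trans (cong label e) (label-place nothing))) λ ()
      ; b-neighbour = place (just u₂) , trans (adj-place nothing (just u₂)) v₂u₂ ,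
          λ e → u₂≢v (just-injective (trans (≡-sym (label-place (just u₂))) (trans (cong label e) (label-place (just v)))))
      ; old-degree = old-degree
      ; new-degrees = trans (cong₂ _+_ (deg-place (just v)) (deg-place nothing))
          (trans new-labelDegrees (cong (_+ 2) (regular v))) }
      where
      c⁻ : Fin (suc m) → Fin (suc m) → Fin k
      c⁻ z w = c (ψ z) (ψ w)

      proper : ProperEdgeColoring G⁻ k c⁻
      proper = (λ z w zw → c-sym _ _ (project-edge zw)) , λ z w w′ zw zw′ e →
        edges-injective (adj-flip G⁻ zw) (adj-flip G⁻ zw′)
          (c-proper _ _ _ (project-edge zw) (project-edge zw′) e) refl

      open FromColouring G⁻ c⁻ proper

      covers : CoversBut G matchings v₁ v₂
      covers z w zw with pair? v₁ v₂ z w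
      ... | yes e = inj₂ e
      ... | no ne = inj₁ (matchings-cover z w (delete⁺ G v₁ v₂ zw ne))

      ψ-v₁ : ψ v₁ ≡ v
      ψ-v₁ = cong project (label-place (just v))

      ψ-v₂ : ψ v₂ ≡ v
      ψ-v₂ = cong project (label-place nothing)

      v₁≢v₂ : v₁ ≢ v₂
      v₁≢v₂ e = contradiction (trans (≡-sym (label-place (just v))) (trans (cong label e) (label-place nothing))) λ ()

      -- A colour present at both copies would belong to two edges at `v` in `G₀`, hence to a single
      -- one, but that edge is attached to only one copy.
      total : Total matchings v₁ v₂
      total i with matched i v₁ | matched i v₂
      ... | inj₁ e | _ = inj₁ e
      ... | inj₂ _ | inj₁ e = inj₂ e
      ... | inj₂ (e₁ , c₁) | inj₂ (e₂ , c₂) = contradiction (edges-injective e₁ e₂ same same-end) v₁≢v₂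
        where
        same : ψ v₁ ≡ ψ v₂
        same = trans ψ-v₁ (≡-sym ψ-v₂)
        same-end : ψ (mate matchings i v₁) ≡ ψ (mate matchings i v₂)
        same-end = c-proper (ψ v₁) _ _ (project-edge e₁)
          (subst (λ t → adj G₀ t (ψ (mate matchings i v₂)) ≡ true) (≡-sym same) (project-edge e₂))
          (trans c₁ (trans (≡-sym c₂) (cong (λ t → c t (ψ (mate matchings i v₂))) (≡-sym same))))

      v₁v₂ : labelAdj (just v) nothing ≡ true
      v₁v₂ with v ≟ v
      ... | yes _  = refl
      ... | no v≢v = contradiction refl v≢v

      u₁≢v : u₁ ≢ v
      u₁≢v = ≢-sym (adjacent⇒≢ G₀ (proj₁ (∧-true⁻ _ _ vu₁)))

      u₂≢v : u₂ ≢ v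
      u₂≢v = ≢-sym (adjacent⇒≢ G₀ (proj₁ (∧-true⁻ _ _ vu₂)))

      v₁u₁ : labelAdj (just v) (just u₁) ≡ true
      v₁u₁ with v ≟ v | u₁ ≟ v
      ... | no v≢v | _       = contradiction refl v≢v
      ... | yes _  | yes u≡v = contradiction u≡v u₁≢v
      ... | yes _  | no _    = vu₁

      v₂u₂ : labelAdj nothing (just u₂) ≡ true
      v₂u₂ with u₂ ≟ v
      ... | yes _ = refl
      ... | no _  = vu₂

      deg-place : ∀ s → deg G (place s) ≡ labelDegree s
      deg-place s = trans (deg-label (place s)) (cong labelDegree (label-place s))

      old-degree : ∀ {z} → z ≢ v₁ → z ≢ v₂ → deg G z ≡ k
      old-degree {z} z≢v₁ z≢v₂ with label z in e
      ... | nothing = contradiction (trans (≡-sym (place-label z)) (cong place e)) z≢v₂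
      ... | just a = trans (trans (deg-label z) (cong labelDegree e)) (trans (old-labelDegree a≢v) (regular a))
        where
        a≢v : a ≢ v
        a≢v refl = z≢v₁ (trans (≡-sym (place-label z)) (cong place e))

-- Criticality of the split graph

module SplitGraph {n k} {G : Graph n} {a b} (S : IsSplit k G a b) where

  open IsSplit S

  a≢b : a ≢ b
  a≢b = adjacent⇒≢ G ab-adjacent

  deg-b≥2 : 2 ≤ deg G b
  deg-b≥2 = two-neighbours G (adj-flip G ab-adjacent) (proj₁ (proj₂ b-neighbour)) (≢-sym (proj₂ (proj₂ b-neighbour)))

  deg-a≤k : deg G a ≤ k
  deg-a≤k = +-cancelʳ-≤ 2 (deg G a) k (≤-trans (+-monoʳ-≤ (deg G a) deg-b≥2) (≤-reflexive new-degrees))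

  -- By parity each colour is missing at some vertex, and the old vertices, having degree `k`, miss
  -- none. So each colour is present at no more than one of `a` and `b`, too few for their k + 2
  -- edge ends.
  not-colourable : (∀ h → n ≢ h + h) → ¬ EdgeColorable G k
  not-colourable odd (c , proper) = <-irrefl refl (begin-strict
    k                                       <⟨ m<m+n k (s≤s z≤n) ⟩
    k + 2                                   ≡⟨ new-degrees ⟨
    deg G a + deg G b                       ≤⟨ +-mono-≤ (deg≤colours G matchings matchings-cover a)
                                                        (deg≤colours G matchings matchings-cover b) ⟩
    ∑[ i < k ] at-a i + ∑[ i < k ] at-b i   ≡⟨ ∑-distrib-+ at-a at-b ⟨
    ∑[ i < k ] (at-a i + at-b i)            ≤⟨ sum-≤-const (λ i → at-a i + at-b i) 1 pointwise ⟩
    k * 1                                   ≡⟨ *-identityʳ k ⟩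
    k                                       ∎)
    where
    open ≤-Reasoning
    open FromColouring G c proper
    at-a at-b : Fin k → ℕ
    at-a i = moves (mate matchings i) a
    at-b i = moves (mate matchings i) b
    missing-somewhere : ∀ i → ∃ λ v → Misses matchings i v
    missing-somewhere i with any? (λ v → mate matchings i v ≟ v)
    ... | yes fixed = fixed
    ... | no none with fixed-point-free⇒even (mate matchings i) (mate-involutive matchings i) (λ v e → none (v , e))
    ...   | h , n≡h+h = contradiction n≡h+h (odd h)
    pointwise : ∀ i → at-a i + at-b i ≤ 1
    pointwise i with missing-somewhere i
    ... | v , v-missed with v ≟ a | v ≟ b
    ...   | yes refl | _ rewrite moves-fixed (mate matchings i) v-missed = moves≤1 (mate matchings i) b
    ...   | no _ | yes refl rewrite moves-fixed (mate matchings i) v-missed | +-identityʳ (at-a i) =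
            moves≤1 (mate matchings i) a
    ...   | no v≢a | no v≢b =
            contradiction v-missed (full-degree⇒¬misses G matchings matchings-cover (old-degree v≢a v≢b) i)

  -- For `z` other than `b`, the colour of az is missing at `b` and can be moved to ab.
  uncover-at-a : ∀ {z} → adj G a z ≡ true → ∃ λ (M : Matchings k n) → CoversBut G M a z
  uncover-at-a {z} az with covers a z az
  ... | inj₂ (inj₁ (_ , refl)) = colouring , covers
  ... | inj₂ (inj₂ (a≡b , _))  = contradiction a≡b a≢b
  ... | inj₁ (γ , γaz) with total γ
  ...   | inj₁ γa = contradiction (trans (≡-sym γa) γaz) (adjacent⇒≢ G az)
  ...   | inj₂ γb = slideColour , subst (CoversBut G slideColour a) γaz (slideColour-coversBut G covers)
    where open SlideColour colouring {γ} {a} {b} a≢b γb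

module _ {m k} {G : Graph (suc m)} {a b} (S : IsSplit (suc k) G a b) (dense : 3 * m ≤ 4 * suc k) where

  open IsSplit S

  far-edge-critical : ∀ {x y} → adj G x y ≡ true → x ≢ a → x ≢ b → y ≢ a → y ≢ b →
    EdgeColorable (delete G x y) (suc k)
  far-edge-critical {x} {y} xy x≢a x≢b y≢a y≢b =
    decidable-stable (colourable? (delete G x y) (suc k)) λ ¬colourable →
      FarEdge.near-impossible G x y x≢y (uncoverable ¬colourable) refl dense (s≤s z≤n) (near ¬colourable)
    where
    uncoverable : ¬ EdgeColorable (delete G x y) (suc k) → ∀ M → ¬ Covers (delete G x y) M
    uncoverable ¬colourable M cov = ¬colourable (covered⇒colourable (delete G x y) M cov)
    x≢y : x ≢ y
    x≢y = adjacent⇒≢ G xy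
    xy-colour : Covered colouring x y
    xy-colour with covers x y xy
    ... | inj₁ c = c
    ... | inj₂ (inj₁ (x≡a , _)) = contradiction x≡a x≢a
    ... | inj₂ (inj₂ (x≡b , _)) = contradiction x≡b x≢b
    α : Fin (suc k)
    α = proj₁ xy-colour
    -- The edge xy is taken out of its colour class, so that both ends miss `α` as `Near` demands.
    open Replace colouring α (cut (mate colouring α) x) (cut-involutive _ x (mate-involutive colouring α))
    still-missing : ∀ {i v} → Misses colouring i v → Misses replace i v
    still-missing {i} {v} iv = by-colour (i ≟ α)
      where
      by-colour : Dec (i ≡ α) → Misses replace i v
      by-colour (yes refl) = trans (replace-at v) (cut-fixed (mate colouring α) x iv)
      by-colour (no i≢α)   = trans (replace-other i≢α v) iv
    still-covered : ∀ {u v} → ¬ Pair x y u v → Covered colouring u v → Covered replace u v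
    still-covered {u} {v} ne (i , e) = by-colour (i ≟ α)
      where
      by-colour : Dec (i ≡ α) → Covered replace u v
      by-colour (no i≢α)   = i , trans (replace-other i≢α u) e
      by-colour (yes refl) = i , trans (replace-at u) (trans (cut-other (mate colouring α) x u≢x u≢y) e)
        where
        u≢x : u ≢ x
        u≢x refl = ne (inj₁ (refl , trans (≡-sym e) (proj₂ xy-colour)))
        u≢y : u ≢ mate colouring α x
        u≢y refl = ne (inj₂ (proj₂ xy-colour , trans (≡-sym e) (mate-involutive colouring α x)))
    near : ∀ ¬colourable → FarEdge.Near G x y x≢y (uncoverable ¬colourable) a b replace α
    near _ = record
      { split = S ; x≢a = x≢a ; x≢b = x≢b ; y≢a = y≢a ; y≢b = y≢b
      ; covers = λ u v uv → covered-or-ab (proj₂ (delete⁻ G x y {u} {v} uv)) (covers u v (proj₁ (delete⁻ G x y {u} {v} uv)))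
      ; total = λ i → Sum.map still-missing still-missing (total i)
      ; α-misses-x = trans (replace-at x) (cut-at (mate colouring α) x)
      ; α-misses-y = subst (λ v → mate replace α v ≡ v) (proj₂ xy-colour)
          (trans (replace-at _) (cut-at-image (mate colouring α) x)) }
      where
      covered-or-ab : ∀ {u v} → ¬ Pair x y u v → Covered colouring u v ⊎ Pair a b u v → Covered replace u v ⊎ Pair a b u v
      covered-or-ab ne (inj₁ c) = inj₁ (still-covered ne c)
      covered-or-ab ne (inj₂ e) = inj₂ e

  edge-critical : ∀ p q → adj G p q ≡ true → EdgeColorable (delete G p q) (suc k)
  edge-critical p q pq = by-ends (p ≟ a) (p ≟ b) (q ≟ a) (q ≟ b)
    where
    Uncovered : Fin (suc m) → Fin (suc m) → Set
    Uncovered s t = ∃ λ (M : Matchings (suc k) (suc m)) → CoversBut G M s t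
    uncovered : Uncovered p q → EdgeColorable (delete G p q) (suc k)
    uncovered (M , cov) = covered⇒colourable (delete G p q) M (delete-covers G p q M cov)
    reverse : ∀ {s t} → Uncovered s t → Uncovered t s
    reverse (M , cov) = M , coversBut-sym G M cov
    by-ends : Dec (p ≡ a) → Dec (p ≡ b) → Dec (q ≡ a) → Dec (q ≡ b) → EdgeColorable (delete G p q) (suc k)
    by-ends (yes refl) _ _ _ = uncovered (SplitGraph.uncover-at-a S pq)
    by-ends _ (yes refl) _ _ = uncovered (SplitGraph.uncover-at-a (isSplit-flip S) pq)
    by-ends _ _ (yes refl) _ = uncovered (reverse (SplitGraph.uncover-at-a S (adj-flip G pq)))
    by-ends _ _ _ (yes refl) = uncovered (reverse (SplitGraph.uncover-at-a (isSplit-flip S) (adj-flip G pq)))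
    by-ends (no p≢a) (no p≢b) (no q≢a) (no q≢b) = far-edge-critical pq p≢a p≢b q≢a q≢b

  -- As no vertex is isolated, a subgraph that misses a vertex misses an edge, and deleting single
  -- edges is enough for criticality.
  some-edge : ∀ v → ∃ λ z → adj G v z ≡ true
  some-edge v with any? (λ z → adj G v z ≟ᵇ true)
  ... | yes edge = edge
  ... | no none  = contradiction deg≡0 (>⇒≢ deg>0)
    where
    deg≡0 : deg G v ≡ 0
    deg≡0 = trans (deg≡sum G v)
      (trans (sum-cong-≗ (λ z → cong ι (¬-not (λ e → none (z , e))))) (sum-replicate-zero (suc m)))
    deg>0 : 0 < deg G v
    deg>0 with v ≟ a | v ≟ b
    ... | yes refl | _        = ≤-trans (s≤s z≤n) (SplitGraph.deg-b≥2 (isSplit-flip S))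
    ... | no _     | yes refl = ≤-trans (s≤s z≤n) (SplitGraph.deg-b≥2 S)
    ... | no v≢a   | no v≢b rewrite old-degree v≢a v≢b = s≤s z≤n

  proper-subgraph-colourable : ∀ {l} (H : Graph l) (f : Fin l → Fin (suc m)) →
    IsSubgraph H G f → ProperSub H G f → EdgeColorable H (suc k)
  proper-subgraph-colourable H f (f-inj , f-adj) proper-sub = avoid (missed-edge proper-sub)
    where
    MissedEdge : Set
    MissedEdge = ∃ λ p → ∃ λ q → adj G p q ≡ true × (∀ s t → f s ≡ p → f t ≡ q → adj H s t ≡ false)
    missed-edge : ProperSub H G f → MissedEdge
    missed-edge (inj₂ edge) = edge
    missed-edge (inj₁ (v , v-missed)) with some-edge v
    ... | z , vz = v , z , vz , λ s t fs≡v _ → contradiction fs≡v (v-missed s)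
    avoid : MissedEdge → EdgeColorable H (suc k)
    avoid (p , q , pq , missed) with edge-critical p q pq
    ... | c , c-sym , c-proper =
      (λ s t → c (f s) (f t)) , (λ s t st → c-sym (f s) (f t) (kept st)) ,
      λ s t t′ st st′ e → f-inj (c-proper (f s) (f t) (f t′) (kept st) (kept st′) e)
      where
      kept : ∀ {s t} → adj H s t ≡ true → adj (delete G p q) (f s) (f t) ≡ true
      kept {s} {t} st = delete⁺ G p q (f-adj s t st) λ
        { (inj₁ (e , e′)) → true≢false (trans (≡-sym st) (missed s t e e′))
        ; (inj₂ (e , e′)) → true≢false (trans (≡-sym (adj-flip H st)) (missed t s e′ e)) }

  split-critical : (∀ h → suc m ≢ h + h) → Critical G (suc k)
  split-critical odd = max-degree , (plus-one , lower) , subgraphs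
    where
    open SplitGraph S
    deg≤ : ∀ v → deg G v ≤ suc k
    deg≤ v with v ≟ a | v ≟ b
    ... | yes refl | _        = deg-a≤k
    ... | no _     | yes refl = SplitGraph.deg-a≤k (isSplit-flip S)
    ... | no v≢a   | no v≢b   = ≤-reflexive (old-degree v≢a v≢b)
    max-degree : maxDeg G ≡ suc k
    -- The maximum is attained at an old vertex; the neighbour of `a` other than `b` is one.
    max-degree with a-neighbour
    ... | z , az , z≢b = maxDeg≡ G deg≤ z (old-degree (≢-sym (adjacent⇒≢ G az)) z≢b)
    plus-one : EdgeColorable G (suc (suc k))
    plus-one with extra-colour {G = G} colouring a≢b covers
    ... | M , cov = covered⇒colourable G M cov
    lower : ∀ j → EdgeColorable G j → suc (suc k) ≤ j
    lower j colouring = ≰⇒> λ j≤k → not-colourable odd (colourable-mono {G = G} j≤k colouring)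
    subgraphs : ∀ l (H : Graph l) (f : Fin l → Fin (suc m)) → IsSubgraph H G f → ProperSub H G f →
      ∃ λ j → ChromaticIndex H j × j < suc (suc k)
    subgraphs l H f sub proper-sub with chromatic-index H (suc k) (proper-subgraph-colourable H f sub proper-sub)
    ... | j , index , j≤k = j , index , s≤s j≤k

theorem1p1 : (m Δ : ℕ) → 1 ≤ Δ → 3 * m ≤ 4 * Δ →
    (G₀ : Graph m) → Regular G₀ Δ → Class1 G₀ →
    (G : Graph (suc m)) → IsVertexSplitting G₀ G →
    Critical G Δ
theorem1p1 m (suc k) _ dense G₀ regular (maxDeg-colourable , _) G (v , side , u₁ , u₂ , π , iso) =
  split-critical (Splitting.isSplit G₀ v side G π iso regular colourable u₁ u₂) dense odd
  where
  colourable : EdgeColorable G₀ (suc k)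
  -- The split vertex `v` witnesses that the degree is attained; on an empty vertex set `maxDeg`
  -- would be 0.
  colourable = subst (EdgeColorable G₀) (maxDeg≡ G₀ (λ z → ≤-reflexive (regular z)) v (regular v)) maxDeg-colourable
  open FromColouring G₀ (proj₁ colourable) (proj₂ colourable)
  -- With as many colours as the degree of the regular graph `G₀`, every colour class is a perfect
  -- matching, so `m` is even. Colour `zero` exists because the degree is positive.
  odd : ∀ h → suc m ≢ h + h
  odd h e with fixed-point-free⇒even (mate matchings zero) (mate-involutive matchings zero)
                 (λ z → full-degree⇒¬misses G₀ matchings matchings-cover (regular z) zero)
  ... | h₀ , m≡h₀+h₀ = even⇒suc-odd h₀ h (trans (cong suc (≡-sym m≡h₀+h₀)) e)
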